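{- For all integers $r\ge1$, $\pi_{3r}(rK_3)=\pi_3(K_3)=\frac{ -1+\sqrt5}{2}$.
   Context: Graphs are finite and simple. An $m$-partite graph $G$ is a graph with a vertex partition $V = V_1\sqcup\dots\sqcup V_m$ into nonempty parts such that no edge has both ends in the same part. For disjoint nonempty vertex sets $X,Y$, the edge density is $d(X,Y) = \frac{e(X,Y)}{|X||Y|}$, where $e(X,Y)$ is the number of edges between $X$ and $Y$. The $m$-partite density of $G$ is $d_m(G) = \min_{1\le i<j\le m} d(V_i,V_j)$. A traversal of $G$ is a subgraph (on $m$ vertices) containing exactly one vertex from each part. For a graph $F$, $G$ contains an $F$-traversal if some traversal of $G$ contains $F$ as a subgraph (up to isomorphism). The critical density is $$\pi_m(F) = \sup\{\alpha\in[0,1] : \text{there exists an } m\text{ -partite graph } G \text{ with } d_m(G)\ge\alpha \text{ and no } F\text{ -traversal}\}.$$ $rK_3$ denotes the graph consisting of $r$ vertex-disjoint copies of the triangle $K_3$. -}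

module Defs where

open import Level using (Level; 0ℓ)
open import Data.Empty using (⊥)
open import Data.Fin.Base as Fin using (Fin; quotient; remainder)
import Data.Fin.Properties as Fin
open import Data.Integer.Base using (+_)
open import Data.List.Base
  using (List; _∷_; length; filter; map; allFin; cartesianProduct)
import Data.List.Extrema as Extrema
open import Data.List.Membership.Propositional using (_∈_)
open import Data.List.Membership.Propositional.Properties using (∈-filter⁺; ∈-allFin)
open import Data.Nat.Base as ℕ using (ℕ)
import Data.Nat.Properties as ℕ
open import Data.Product using (∃; ∃-syntax; ∃!; _×_; _,_; uncurry)
open import Data.Rational.Base
open import Data.Rational.Properties
open import Data.Rational.Solver using (module +-*-Solver)
open import Data.Sum.Base using (_⊎_; inj₁; inj₂)
open import Function.Bundles using (_⇔_; mk⇔; module Equivalence)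
open import Function.Definitions using (Injective; StrictlySurjective)
open import Relation.Binary.Bundles using (DecTotalOrder)
open import Relation.Binary.Core using (Rel)
open import Relation.Binary.Definitions
  using (Decidable; Irreflexive; Symmetric; tri<; tri≈; tri>)
open import Relation.Binary.PropositionalEquality
open import Relation.Nullary using (¬_; yes; no; contradiction)
open import Relation.Nullary.Decidable using (_×-dec_; ¬?)
open import Relation.Unary using (Pred)

private variable
  ℓ : Level
  m : ℕ

------------------------------------------------------------------------
-- Real numbers

-- Two-sided Dedekind cuts: lower q means q < x, and upper q means x < q.

record ℝ : Set₁ where
  field
    lower upper     : Pred ℚ 0ℓ
    lower-inhabited : ∃ lower
    upper-inhabited : ∃ upper
    lower-rounded   : ∀ {q} → lower q ⇔ (∃[ r ] q < r × lower r)
    upper-rounded   : ∀ {q} → upper q ⇔ (∃[ r ] r < q × upper r)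
    disjoint        : ∀ {q} → lower q → upper q → ⊥
    located         : ∀ {q r} → q < r → lower q ⊎ upper r

open ℝ

infix 4 _≤ᵣ_
_≤ᵣ_ : Rel ℝ 0ℓ
x ≤ᵣ y = ∀ {q} → lower x q → lower y q

private
  p<p+1 : ∀ p → p < p + 1ℚ
  p<p+1 p = subst (_< p + 1ℚ) (+-identityʳ p) (+-monoʳ-< p (positive⁻¹ 1ℚ))

  p-1<p : ∀ p → p - 1ℚ < p
  p-1<p p = subst (p - 1ℚ <_) (+-identityʳ p) (+-monoʳ-< p (negative⁻¹ (- 1ℚ)))

fromℚ : ℚ → ℝ
fromℚ p .lower q = q < p
fromℚ p .upper q = p < q
fromℚ p .lower-inhabited = p - 1ℚ , p-1<p p
fromℚ p .upper-inhabited = p + 1ℚ , p<p+1 p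
fromℚ p .lower-rounded =
  mk⇔ <-dense (λ (_ , q<r , r<p) → <-trans q<r r<p)
fromℚ p .upper-rounded =
  mk⇔ (λ p<q → let r , p<r , r<q = <-dense p<q in r , r<q , p<r)
      (λ (_ , r<q , p<r) → <-trans p<r r<q)
fromℚ p .disjoint = <-asym
fromℚ p .located {q} {r} q<r with q <? p
... | yes q<p = inj₁ q<p
... | no  q≮p = inj₂ (≤-<-trans (≮⇒≥ q≮p) q<r)

private
  -- The real f⁻¹(x), for an increasing bijection f of ℚ with inverse g.
  preimage : (f g : ℚ → ℚ) →
             (∀ {p q} → p < q → f p < f q) → (∀ {p q} → p < q → g p < g q) →
             (∀ q → f (g q) ≡ q) → (∀ q → g (f q) ≡ q) → ℝ → ℝ
  preimage f g f-mono g-mono fg gf x = λ where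
      .lower q → lower x (f q)
      .upper q → upper x (f q)
      .lower-inhabited → let q , l = lower-inhabited x in
        g q , subst (lower x) (sym (fg q)) l
      .upper-inhabited → let q , u = upper-inhabited x in
        g q , subst (upper x) (sym (fg q)) u
      .lower-rounded → mk⇔
        (λ l → let r , fq<r , l′ = Equivalence.to (lower-rounded x) l in
          g r , subst (_< g r) (gf _) (g-mono fq<r) , subst (lower x) (sym (fg r)) l′)
        (λ (r , q<r , l) → Equivalence.from (lower-rounded x) (f r , f-mono q<r , l))
      .upper-rounded → mk⇔
        (λ u → let r , r<fq , u′ = Equivalence.to (upper-rounded x) u in
          g r , subst (g r <_) (gf _) (g-mono r<fq) , subst (upper x) (sym (fg r)) u′)
        (λ (r , r<q , u) → Equivalence.from (upper-rounded x) (f r , f-mono r<q , u))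
      .disjoint → disjoint x
      .located q<r → located x (f-mono q<r)

-- The sum c + x:  q < c + x  iff  q - c < x.

infixl 6 _⊕_
_⊕_ : ℚ → ℝ → ℝ
c ⊕ x = preimage (_- c) (_+ c) (+-monoˡ-< (- c)) (+-monoˡ-< c) +c-c -c+c x
  where
  open +-*-Solver
  +c-c : ∀ q → q + c - c ≡ q
  +c-c q = solve 2 (λ q c → q :+ c :- c := q) refl q c
  -c+c : ∀ q → q - c + c ≡ q
  -c+c q = solve 2 (λ q c → q :- c :+ c := q) refl q c

-- The quotient x / s:  q < x / s  iff  q * s < x.

infixl 7 _⊘_
_⊘_ : ℝ → (s : ℚ) → .{{Positive s}} → ℝ
x ⊘ s = preimage (_* s) (_÷ s) (*-monoˡ-<-pos s) (*-monoˡ-<-pos (1/ s) {{1/pos⇒pos s}})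
                 ÷s*s *s÷s x
  where
  instance _ = pos⇒nonZero s
  ÷s*s : ∀ q → q ÷ s * s ≡ q
  ÷s*s q = trans (*-assoc q (1/ s) s) (trans (cong (q *_) (*-inverseˡ s)) (*-identityʳ q))
  *s÷s : ∀ q → q * s ÷ s ≡ q
  *s÷s q = trans (*-assoc q s (1/ s)) (trans (cong (q *_) (*-inverseʳ s)) (*-identityʳ q))

private
  0≤* : ∀ {p q} → 0ℚ ≤ p → 0ℚ ≤ q → 0ℚ ≤ p * q
  0≤* {p} {q} 0≤p 0≤q =
    subst (_≤ p * q) (*-zeroˡ q) (*-monoʳ-≤-nonNeg q {{nonNegative 0≤q}} 0≤p)

  0<* : ∀ {p q} → 0ℚ < p → 0ℚ < q → 0ℚ < p * q
  0<* {p} {q} 0<p 0<q =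
    subst (_< p * q) (*-zeroˡ q) (*-monoˡ-<-pos q {{positive 0<q}} 0<p)

  sq-mono-≤ : ∀ {p q} → 0ℚ ≤ p → p ≤ q → p * p ≤ q * q
  sq-mono-≤ {p} {q} 0≤p p≤q = ≤-trans
    (*-monoʳ-≤-nonNeg p {{nonNegative 0≤p}} p≤q)
    (*-monoˡ-≤-nonNeg q {{nonNegative (≤-trans 0≤p p≤q)}} p≤q)

  sq-mono-< : ∀ {p q} → 0ℚ ≤ p → p < q → p * p < q * q
  sq-mono-< {p} {q} 0≤p p<q = ≤-<-trans
    (*-monoʳ-≤-nonNeg p {{nonNegative 0≤p}} (<⇒≤ p<q))
    (*-monoʳ-<-pos q {{positive (≤-<-trans 0≤p p<q)}} p<q)

  diff-pos : ∀ {p q} → p < q → 0ℚ < q - p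
  diff-pos {p} {q} p<q = subst (_< q - p) (+-inverseʳ p) (+-monoˡ-< (- p) p<q)

  +-pos⇒< : ∀ {p q} → 0ℚ < q → p < p + q
  +-pos⇒< {p} {q} 0<q = subst (_< p + q) (+-identityʳ p) (+-monoʳ-< p 0<q)

  -- For q ≥ 0 put k = a + 1 and w = (q k + a) / (q + k).  Then w lies strictly
  -- between q and √a, since  a (q + k)² - (q k + a)² = (k² - a) (a - q²).
  module Refine (a : ℚ) (0≤a : 0ℚ ≤ a) (q : ℚ) (0≤q : 0ℚ ≤ q) where
    open +-*-Solver
    k D N w c : ℚ
    k = a + 1ℚ
    D = q + k
    N = q * k + a
    c = k * k - a

    0<k : 0ℚ < k
    0<k = ≤-<-trans 0≤a (p<p+1 a)

    0<D : 0ℚ < D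
    0<D = +-mono-≤-< 0≤q 0<k

    0<c : 0ℚ < c
    0<c = subst (0ℚ <_)
      (solve 1 (λ a → a :* a :+ (a :+ con 1ℚ)
                   := (a :+ con 1ℚ) :* (a :+ con 1ℚ) :- a) refl a)
      (+-mono-≤-< (0≤* 0≤a 0≤a) 0<k)

    instance
      D-pos : Positive D
      D-pos = positive 0<D
      D-nonNeg : NonNegative D
      D-nonNeg = nonNegative (<⇒≤ 0<D)
      D-nonZero : NonZero D
      D-nonZero = pos⇒nonZero D
      DD-nonNeg : NonNegative (D * D)
      DD-nonNeg = nonNegative (0≤* (<⇒≤ 0<D) (<⇒≤ 0<D))

    w = N ÷ D

    wD : w * D ≡ N
    wD = trans (*-assoc N (1/ D) D) (trans (cong (N *_) (*-inverseˡ D)) (*-identityʳ N))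

    wwDD : w * w * (D * D) ≡ N * N
    wwDD = trans (solve 2 (λ w D → w :* w :* (D :* D) := (w :* D) :* (w :* D)) refl w D)
                 (cong₂ _*_ wD wD)

    qD : q * k + q * q ≡ q * D
    qD = solve 2 (λ q k → q :* k :+ q :* q := q :* (q :+ k)) refl q k

    up : q * q < a → q < w × w * w < a
    up qq<a =
      *-cancelʳ-<-nonNeg D (subst₂ _<_ qD (sym wD) (+-monoʳ-< (q * k) qq<a)) ,
      *-cancelʳ-<-nonNeg (D * D) (subst₂ _<_ (sym wwDD)
        (solve 3 (λ a q k →
            (q :* k :+ a) :* (q :* k :+ a) :+ (k :* k :- a) :* (a :- q :* q)
            := a :* ((q :+ k) :* (q :+ k))) refl a q k)
        (+-pos⇒< (0<* 0<c (diff-pos qq<a))))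

    down : a < q * q → w < q × a < w * w
    down a<qq =
      *-cancelʳ-<-nonNeg D (subst₂ _<_ (sym wD) qD (+-monoʳ-< (q * k) a<qq)) ,
      *-cancelʳ-<-nonNeg (D * D) (subst₂ _<_ refl
        (trans (solve 3 (λ a q k →
            a :* ((q :+ k) :* (q :+ k)) :+ (k :* k :- a) :* (q :* q :- a)
            := (q :* k :+ a) :* (q :* k :+ a)) refl a q k) (sym wwDD))
        (+-pos⇒< (0<* 0<c (diff-pos a<qq))))

    w-pos : 0ℚ < q → 0ℚ < w
    w-pos 0<q = *-cancelʳ-<-nonNeg D
      (subst₂ _<_ (sym (*-zeroˡ D)) (sym wD) (+-mono-<-≤ (0<* 0<q 0<k) 0≤a))

√_ : (a : ℚ) → .{{NonNegative a}} → ℝ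
√ a = λ where
    .lower q → q < 0ℚ ⊎ q * q < a
    .upper q → 0ℚ < q × a < q * q
    .lower-inhabited → - 1ℚ , inj₁ (negative⁻¹ (- 1ℚ))
    .upper-inhabited → a + 1ℚ , 0<a+1 , a<[a+1]²
    .lower-rounded → mk⇔ raise drop
    .upper-rounded → mk⇔
      (λ {(0<q , a<qq) → let open Refine a 0≤a _ (<⇒≤ 0<q)
                             w<q , a<ww = down a<qq
                         in w , w<q , w-pos 0<q , a<ww})
      (λ {(r , r<q , 0<r , a<rr) →
        <-trans 0<r r<q , <-trans a<rr (sq-mono-< (<⇒≤ 0<r) r<q)})
    .disjoint → λ where
      (inj₁ q<0)  (0<q , _)    → <-asym q<0 0<q
      (inj₂ qq<a) (_   , a<qq) → <-asym qq<a a<qq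
    .located → locate
  where
  0≤a : 0ℚ ≤ a
  0≤a = nonNegative⁻¹ a

  L : Pred ℚ 0ℓ
  L q = q < 0ℚ ⊎ q * q < a

  0<a+1 : 0ℚ < a + 1ℚ
  0<a+1 = ≤-<-trans 0≤a (p<p+1 a)

  a<[a+1]² : a < (a + 1ℚ) * (a + 1ℚ)
  a<[a+1]² = <-≤-trans (p<p+1 a) (subst (_≤ (a + 1ℚ) * (a + 1ℚ)) (*-identityˡ (a + 1ℚ))
    (*-monoʳ-≤-nonNeg (a + 1ℚ) {{nonNegative (<⇒≤ 0<a+1)}}
      (subst (_≤ a + 1ℚ) (+-identityˡ 1ℚ) (+-monoˡ-≤ 1ℚ 0≤a))))

  raise : ∀ {q} → L q → ∃[ r ] q < r × L r
  raise {q} l with q <? 0ℚ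
  raise {q} l           | yes q<0 = let r , q<r , r<0 = <-dense q<0 in r , q<r , inj₁ r<0
  raise {q} (inj₁ q<0)  | no  q≮0 = contradiction q<0 q≮0
  raise {q} (inj₂ qq<a) | no  q≮0 =
    let open Refine a 0≤a q (≮⇒≥ q≮0)
        q<w , ww<a = up qq<a
    in w , q<w , inj₂ ww<a

  drop : ∀ {q} → ∃[ r ] q < r × L r → L q
  drop {q} (r , q<r , l) with q <? 0ℚ
  drop {q} (r , q<r , l)         | yes q<0 = inj₁ q<0
  drop {q} (r , q<r , inj₁ r<0)  | no  q≮0 = contradiction (<-trans q<r r<0) q≮0
  drop {q} (r , q<r , inj₂ rr<a) | no  q≮0 =
    inj₂ (<-trans (sq-mono-< (≮⇒≥ q≮0) q<r) rr<a)

  locate : ∀ {q r} → q < r → L q ⊎ (0ℚ < r × a < r * r)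
  locate {q} {r} q<r with q <? 0ℚ | q * q <? a
  ... | yes q<0 | _        = inj₁ (inj₁ q<0)
  ... | no  _   | yes qq<a = inj₁ (inj₂ qq<a)
  ... | no  q≮0 | no  qq≮a = inj₂
    (≤-<-trans (≮⇒≥ q≮0) q<r , ≤-<-trans (≮⇒≥ qq≮a) (sq-mono-< (≮⇒≥ q≮0) q<r))

IsSupremum : Pred ℝ ℓ → ℝ → Set _
IsSupremum S s =
  (∀ {x} → S x → x ≤ᵣ s) × (∀ {b} → (∀ {x} → S x → x ≤ᵣ b) → s ≤ᵣ b)

------------------------------------------------------------------------
-- Graphs

record Graph : Set₁ where
  infix 4 _~_ _~?_
  field
    order  : ℕ
    _~_    : Rel (Fin order) 0ℓ
    _~?_   : Decidable _~_
    ~-sym  : Symmetric _~_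
    ~-irr  : Irreflexive _≡_ _~_

  Vertex : Set
  Vertex = Fin order

-- Subgraph inclusion, up to isomorphism.

infix 4 _⊑_
record _⊑_ (F G : Graph) : Set where
  private
    module F = Graph F
    module G = Graph G
  field
    ⟦_⟧       : F.Vertex → G.Vertex
    injective : Injective _≡_ _≡_ ⟦_⟧
    edge      : ∀ {u v} → u F.~ v → ⟦ u ⟧ G.~ ⟦ v ⟧

open _⊑_ using (⟦_⟧)

K : ℕ → Graph
K n = record
  { order = n
  ; _~_   = _≢_
  ; _~?_  = λ u v → ¬? (u Fin.≟ v)
  ; ~-sym = ≢-sym
  ; ~-irr = λ u≡v u≢v → u≢v u≡v
  }

-- r vertex-disjoint copies of F; vertex x is vertex remainder x of copy quotient x.

infixr 7 _·_
_·_ : ℕ → Graph → Graph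
r · F = record
  { order = r ℕ.* n
  ; _~_   = λ x y → copy x ≡ copy y × vertex x F.~ vertex y
  ; _~?_  = λ x y → (copy x Fin.≟ copy y) ×-dec (vertex x F.~? vertex y)
  ; ~-sym = λ (c≡c′ , v~v′) → sym c≡c′ , F.~-sym v~v′
  ; ~-irr = λ x≡y (_ , v~v′) → F.~-irr (cong vertex x≡y) v~v′
  }
  where
  module F = Graph F
  n = F.order
  copy : Fin (r ℕ.* n) → Fin r
  copy = quotient n
  vertex : Fin (r ℕ.* n) → Fin n
  vertex = remainder {r} n

record PartiteGraph (m : ℕ) : Set₁ where
  field
    graph : Graph
  open Graph graph public
  field
    part          : Vertex → Fin m
    part-nonempty : StrictlySurjective _≡_ part
    part-edgeless : ∀ {u v} → u ~ v → part u ≢ part v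

  V : Fin m → List Vertex
  V i = filter (λ v → part v Fin.≟ i) (allFin order)

  ∣V_∣ : Fin m → ℕ
  ∣V i ∣ = length (V i)

  instance
    ∣V∣-nonZero : ∀ {i} → ℕ.NonZero ∣V i ∣
    ∣V∣-nonZero {i} = let v , v∈i = part-nonempty i in
      nonEmpty (∈-filter⁺ (λ v → part v Fin.≟ i) (∈-allFin v) v∈i)
      where
      nonEmpty : ∀ {v xs} → v ∈ xs → ℕ.NonZero (length xs)
      nonEmpty {xs = _ ∷ _} _ = _

  e : Fin m → Fin m → ℕ
  e i j = length (filter (uncurry _~?_) (cartesianProduct (V i) (V j)))

  d : Fin m → Fin m → ℚ
  d i j = (+ e i j / (∣V i ∣ ℕ.* ∣V j ∣)) {{ℕ.m*n≢0 ∣V i ∣ ∣V j ∣}}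

  -- Extrema.min needs a default.  No density exceeds 1, so the default 1 matters
  -- only when there are no pairs i < j, i.e. when m < 2.
  minDensity : ℚ
  minDensity = min 1ℚ
    (map (uncurry d)
      (filter (uncurry Fin._<?_) (cartesianProduct (allFin m) (allFin m))))
    where open Extrema (DecTotalOrder.totalOrder ≤-decTotalOrder) using (min)

open PartiteGraph using (graph; part; minDensity)

record Traversal (G : PartiteGraph m) : Set₁ where
  field
    subgraph : Graph
    embed    : subgraph ⊑ graph G
    one-each : ∀ i → ∃! _≡_ λ v → part G (⟦ embed ⟧ v) ≡ i

HasTraversal : Graph → PartiteGraph m → Set₁
HasTraversal F G = ∃[ T ] F ⊑ Traversal.subgraph {G = G} T

------------------------------------------------------------------------
-- Critical densities

Avoidable : (m : ℕ) → Graph → Pred ℝ _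
Avoidable m F α =
  fromℚ 0ℚ ≤ᵣ α × α ≤ᵣ fromℚ 1ℚ ×
  ∃[ G ] α ≤ᵣ fromℚ (minDensity {m} G) × ¬ HasTraversal F G

-- π[ m ] F ≐ x  says that the supremum defining π_m(F) is x.  A relation, because
-- a bounded set of Dedekind reals need not have a supremum constructively.

infix 4 π[_]_≐_
π[_]_≐_ : ℕ → Graph → ℝ → Set₁
π[ m ] F ≐ x = IsSupremum (Avoidable m F) x

module Submission where

-- Suppose the parts A, B, C have pairwise densities above δ, where δ² + δ ≥ 1, but span
-- no triangle.  For a ∈ A let x(a), y(a) be the fractions of B, C adjacent to a.  For
-- i, j ∈ A no edge of BC lies in N(i) or in N(j), so
--   x(i) y(i) + x(j) y(j) - x(j) y(i) ≤ 1 - d(B, C) < 1 - δ ≤ δ².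
-- If x(i) > δ and y(j) > δ, this forces the segment between the points (x, y)(i) and
-- (x, y)(j) to pass below (δ, δ), so the mean of all points cannot exceed δ in both
-- coordinates.  Applied to r disjoint triples of parts this gives r triangles covering
-- all parts.
--
-- Conversely, if s² + s ≤ 1, let one part consist of apices, let a fraction s of every
-- other part be low, join apices to the low vertices, and join vertices of two other
-- parts unless both are low.  The densities are s and 1 - s², and no apex is in a triangle.

open import Defs
open import Level using (Level; 0ℓ)
open import Data.Bool.Base using (Bool; true; false; T; if_then_else_)
open import Data.Bool.Properties using (T?)
open import Data.Empty using (⊥)
open import Data.Fin.Base as Fin
  using (Fin; zero; suc; quotient; remainder; combine; punchOut)
import Data.Fin.Properties as Fin
open import Data.Integer.Base as ℤ using (+_; -[1+_])
import Data.Integer.Properties as ℤ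
open import Data.List.Base
  using (List; []; _∷_; _++_; length; filter; map; cartesianProduct; allFin; tabulate)
import Data.List.Extrema as Extrema
open import Data.List.Membership.Propositional using (_∈_)
open import Data.List.Membership.Propositional.Properties
  using (∈-allFin; ∈-filter⁺; ∈-filter⁻; ∈-map⁺; ∈-map⁻; ∈-cartesianProduct⁺)
open import Data.List.Membership.Propositional.Properties.WithK using (unique∧set⇒bag)
open import Data.List.Properties using (map-tabulate; length-map; length-tabulate)
open import Data.List.Relation.Binary.BagAndSetEquality using (∼bag⇒↭)
open import Data.List.Relation.Binary.Permutation.Propositional as ↭ using (_↭_)
open import Data.List.Relation.Binary.Permutation.Propositional.Properties using (↭-length)
import Data.List.Relation.Unary.All as All
import Data.List.Relation.Unary.All.Properties as All
open import Data.List.Relation.Unary.Any using (here; there)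
import Data.List.Relation.Unary.Unique.Propositional.Properties as Unique
open import Data.Nat.Base as ℕ using (ℕ; suc)
import Data.Nat.Properties as ℕ
open import Data.Product using (∃; ∃₂; _×_; _,_; uncurry; proj₁; proj₂)
open import Data.Rational.Base
open import Data.Rational.Properties
open import Data.Rational.Solver using (module +-*-Solver)
import Data.Rational.Unnormalised.Base as ℚᵘ
import Data.Rational.Unnormalised.Properties as ℚᵘ
open import Data.Sum.Base using (inj₁; inj₂)
open import Function.Base using (_∘_; id)
open import Function.Bundles using (mk⇔; module Equivalence)
open import Function.Definitions using (Injective)
open import Relation.Binary.Bundles using (DecTotalOrder)
open import Relation.Binary.Core using (Rel)
open import Relation.Binary.Definitions using (Decidable)
open import Relation.Binary.PropositionalEquality
open import Relation.Nullary using (¬_; Dec; yes; no; does; contradiction)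
open import Relation.Nullary.Decidable using (_×-dec_; _⊎-dec_; ¬?; decidable-stable)
open import Relation.Unary using (Pred) renaming (Decidable to Decidable₁)

open +-*-Solver using (solve; con; _:+_; _:*_; _:-_; :-_; _:=_)
open ℝ
open _⊑_ using (⟦_⟧)

private variable
  ℓ : Level
  A B : Set
  P Q R : Set ℓ
  p q s : ℚ
  m n : ℕ
  F F′ : Graph

-- Ordered-field arithmetic

0≤*0≤ : 0ℚ ≤ p → 0ℚ ≤ q → 0ℚ ≤ p * q
0≤*0≤ {p} {q} 0≤p 0≤q =
  subst (_≤ p * q) (*-zeroˡ q) (*-monoʳ-≤-nonNeg q {{nonNegative 0≤q}} 0≤p)

0<*0< : 0ℚ < p → 0ℚ < q → 0ℚ < p * q
0<*0< {p} {q} 0<p 0<q =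
  subst (_< p * q) (*-zeroˡ q) (*-monoˡ-<-pos q {{positive 0<q}} 0<p)

-- Nonlinear inequalities below are proved by naming a nonnegative slack `s` and leaving the
-- identity `p + s ≡ q` to the ring solver.
≤-gap : 0ℚ ≤ s → p + s ≡ q → p ≤ q
≤-gap {s} {p} 0≤s refl = subst (_≤ p + s) (+-identityʳ p) (+-monoʳ-≤ p 0≤s)

p≤q⇒0≤q-p : p ≤ q → 0ℚ ≤ q - p
p≤q⇒0≤q-p {p} {q} p≤q = subst (_≤ q - p) (+-inverseʳ p) (+-monoˡ-≤ (- p) p≤q)

p<q⇒0<q-p : p < q → 0ℚ < q - p
p<q⇒0<q-p {p} {q} p<q = subst (_< q - p) (+-inverseʳ p) (+-monoˡ-< (- p) p<q)

0<q-p⇒p<q : 0ℚ < q - p → p < q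
0<q-p⇒p<q {q} {p} h = subst₂ _<_ (+-identityʳ p)
  (solve 2 (λ p q → p :+ (q :- p) := q) refl p q) (+-monoʳ-< p h)

0≤*-cancelˡ : 0ℚ < s → 0ℚ ≤ s * p → 0ℚ ≤ p
0≤*-cancelˡ {s} {p} 0<s 0≤sp =
  *-cancelˡ-≤-pos s {{positive 0<s}} (subst (_≤ s * p) (sym (*-zeroʳ s)) 0≤sp)

-- The quantity bounded is x y + x′ y′ - x′ y - δ² for (x, y) = (δ + a, δ - e) and
-- (x′, y′) = (δ - c, δ + b).  With κ = 1 - δ, the claim times κ is
--   (κ - b) a (δ - e) + (κ - a) b (δ - c) + (ab - ce)(2δ - c - e) + ce (2δ - κ - c - e),
-- and the last factor is nonnegative because
--   δ (2δ - κ - c - e) = (δ - c)(δ - e) + (κ² - ce) + (δ² + δ - 1).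
perturbation : ∀ {δ a b c e} → 0ℚ < δ → δ < 1ℚ → 1ℚ ≤ δ * δ + δ →
  0ℚ ≤ a → a ≤ 1ℚ - δ → 0ℚ ≤ b → b ≤ 1ℚ - δ →
  0ℚ ≤ c → c ≤ δ → 0ℚ ≤ e → e ≤ δ → c * e ≤ a * b →
  0ℚ ≤ a * (δ - e) + b * (δ - c) - c * e
perturbation {δ} {a} {b} {c} {e} 0<δ δ<1 golden 0≤a a≤κ 0≤b b≤κ 0≤c c≤δ 0≤e e≤δ ce≤ab =
  0≤*-cancelˡ 0<κ (subst (0ℚ ≤_)
    (solve 5 (λ δ a b c e → let κ = con 1ℚ :- δ in
        (κ :- b) :* (a :* (δ :- e)) :+ (κ :- a) :* (b :* (δ :- c))
        :+ (a :* b :- c :* e) :* ((δ :- c) :+ (δ :- e))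
        :+ (c :* e) :* (δ :+ δ :- κ :- c :- e)
        := κ :* (a :* (δ :- e) :+ b :* (δ :- c) :- c :* e)) refl δ a b c e)
    (+-mono-≤ (+-mono-≤ (+-mono-≤
      (0≤*0≤ 0≤κ-b (0≤*0≤ 0≤a 0≤δ-e))
      (0≤*0≤ 0≤κ-a (0≤*0≤ 0≤b 0≤δ-c)))
      (0≤*0≤ (p≤q⇒0≤q-p ce≤ab) (+-mono-≤ 0≤δ-c 0≤δ-e)))
      (0≤*0≤ (0≤*0≤ 0≤c 0≤e) 0≤2δ-κ-c-e)))
  where
  0<κ : 0ℚ < 1ℚ - δ
  0<κ = p<q⇒0<q-p δ<1
  0≤κ-a = p≤q⇒0≤q-p a≤κ
  0≤κ-b = p≤q⇒0≤q-p b≤κ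
  0≤δ-c = p≤q⇒0≤q-p c≤δ
  0≤δ-e = p≤q⇒0≤q-p e≤δ
  0≤2δ-κ-c-e : 0ℚ ≤ δ + δ - (1ℚ - δ) - c - e
  0≤2δ-κ-c-e = 0≤*-cancelˡ 0<δ (subst (0ℚ ≤_)
    (solve 5 (λ δ a b c e → let κ = con 1ℚ :- δ in
        (δ :- c) :* (δ :- e) :+ (a :* b :- c :* e) :+ (κ :* (κ :- a) :+ a :* (κ :- b))
        :+ (δ :* δ :+ δ :- con 1ℚ)
        := δ :* (δ :+ δ :- κ :- c :- e)) refl δ a b c e)
    (+-mono-≤ (+-mono-≤ (+-mono-≤
      (0≤*0≤ 0≤δ-c 0≤δ-e)
      (p≤q⇒0≤q-p ce≤ab))
      (+-mono-≤ (0≤*0≤ (<⇒≤ 0<κ) 0≤κ-a) (0≤*0≤ 0≤a 0≤κ-b)))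
      (p≤q⇒0≤q-p golden)))

-- Naturals as rationals

toℚᵘ-/ : ∀ i n → toℚᵘ (i / suc n) ℚᵘ.≃ ℚᵘ.mkℚᵘ i n
toℚᵘ-/ i n = toℚᵘ-fromℚᵘ (ℚᵘ.mkℚᵘ i n)

-- Abstract, so that conversion never unfolds the gcd normalisation in _/_.
abstract
  ι : ℕ → ℚ
  ι n = + n / 1

  ι-0 : ι 0 ≡ 0ℚ
  ι-0 = refl

  ι-1 : ι 1 ≡ 1ℚ
  ι-1 = refl

  ι-+ : ∀ m n → ι (m ℕ.+ n) ≡ ι m + ι n
  ι-+ m n = toℚᵘ-injective (begin
    toℚᵘ (ι (m ℕ.+ n))            ≈⟨ toℚᵘ-/ (+ (m ℕ.+ n)) 0 ⟩
    ℚᵘ.mkℚᵘ (+ (m ℕ.+ n)) 0       ≈⟨ ℚᵘ.*≡* (cong (ℤ._* + 1)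
        (sym (cong₂ ℤ._+_ (ℤ.*-identityʳ (+ m)) (ℤ.*-identityʳ (+ n))))) ⟩
    ℚᵘ.mkℚᵘ (+ m) 0 ℚᵘ.+ ℚᵘ.mkℚᵘ (+ n) 0
      ≈⟨ ℚᵘ.+-cong (toℚᵘ-/ (+ m) 0) (toℚᵘ-/ (+ n) 0) ⟨
    toℚᵘ (ι m) ℚᵘ.+ toℚᵘ (ι n)    ≈⟨ toℚᵘ-homo-+ (ι m) (ι n) ⟨
    toℚᵘ (ι m + ι n)              ∎)
    where open ℚᵘ.≃-Reasoning

  -- Characterises `_/_` by multiplication, so that densities and weights cancel inside ring
  -- identities.
  /-*-ι : ∀ m n .{{_ : ℕ.NonZero n}} → + m / n * ι n ≡ ι m
  /-*-ι m (suc n) = toℚᵘ-injective (begin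
    toℚᵘ (+ m / suc n * ι (suc n))  ≈⟨ toℚᵘ-homo-* (+ m / suc n) (ι (suc n)) ⟩
    toℚᵘ (+ m / suc n) ℚᵘ.* toℚᵘ (ι (suc n))
      ≈⟨ ℚᵘ.*-cong (toℚᵘ-/ (+ m) n) (toℚᵘ-/ (+ suc n) 0) ⟩
    ℚᵘ.mkℚᵘ (+ m) n ℚᵘ.* ℚᵘ.mkℚᵘ (+ suc n) 0
      ≈⟨ ℚᵘ.*≡* (ℤ.*-assoc (+ m) (+ suc n) (+ 1)) ⟩
    ℚᵘ.mkℚᵘ (+ m) 0                 ≈⟨ toℚᵘ-/ (+ m) 0 ⟨
    toℚᵘ (ι m)                      ∎)
    where open ℚᵘ.≃-Reasoning

ι-suc : ∀ n → ι (suc n) ≡ 1ℚ + ι n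
ι-suc n = trans (ι-+ 1 n) (cong (λ s → s + ι n) ι-1)

ι-* : ∀ m n → ι (m ℕ.* n) ≡ ι m * ι n
ι-* ℕ.zero  n = trans ι-0 (trans (sym (*-zeroˡ (ι n))) (cong (_* ι n) (sym ι-0)))
ι-* (suc m) n = begin
  ι (n ℕ.+ m ℕ.* n)       ≡⟨ ι-+ n (m ℕ.* n) ⟩
  ι n + ι (m ℕ.* n)       ≡⟨ cong (λ s → ι n + s) (ι-* m n) ⟩
  ι n + ι m * ι n         ≡⟨ solve 2 (λ m n → n :+ m :* n := (con 1ℚ :+ m) :* n) refl (ι m) (ι n) ⟩
  (1ℚ + ι m) * ι n        ≡⟨ cong (_* ι n) (ι-suc m) ⟨
  ι (suc m) * ι n         ∎
  where open ≡-Reasoning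

-- Sums and means over lists

infixl 8 _when_
-- Only the Boolean `does P?` enters, so tests computing to the same Boolean give definitionally
-- equal values; `count-<` uses this to pass from `suc b` and `suc M` to `b` and `M`.
_when_ : ℚ → Dec P → ℚ
p when P? = if does P? then p else 0ℚ

𝟙 : Dec P → ℚ
𝟙 P? = 1ℚ when P?

∑ : List A → (A → ℚ) → ℚ
∑ []       f = 0ℚ
∑ (x ∷ xs) f = f x + ∑ xs f

∑-mono : ∀ {f g : A → ℚ} xs → (∀ {x} → x ∈ xs → f x ≤ g x) → ∑ xs f ≤ ∑ xs g
∑-mono []       f≤g = ≤-refl
∑-mono (x ∷ xs) f≤g = +-mono-≤ (f≤g (here refl)) (∑-mono xs (f≤g ∘ there))

∑-cong : ∀ {f g : A → ℚ} xs → (∀ {x} → x ∈ xs → f x ≡ g x) → ∑ xs f ≡ ∑ xs g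
∑-cong xs f≡g = ≤-antisym (∑-mono xs (≤-reflexive ∘ f≡g)) (∑-mono xs (≤-reflexive ∘ sym ∘ f≡g))

∑-+ : ∀ (f g : A → ℚ) xs → ∑ xs (λ x → f x + g x) ≡ ∑ xs f + ∑ xs g
∑-+ f g []       = refl
∑-+ f g (x ∷ xs) = trans (cong (λ s → f x + g x + s) (∑-+ f g xs))
  (solve 4 (λ a b c d → a :+ b :+ (c :+ d) := a :+ c :+ (b :+ d)) refl
    (f x) (g x) (∑ xs f) (∑ xs g))

∑-*ˡ : ∀ c (f : A → ℚ) xs → ∑ xs (λ x → c * f x) ≡ c * ∑ xs f
∑-*ˡ c f []       = sym (*-zeroʳ c)
∑-*ˡ c f (x ∷ xs) = trans (cong (λ s → c * f x + s) (∑-*ˡ c f xs)) (sym (*-distribˡ-+ c (f x) (∑ xs f)))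

∑-const : ∀ c (xs : List A) → ∑ xs (λ _ → c) ≡ c * ι (length xs)
∑-const c []       = trans (sym (*-zeroʳ c)) (cong (c *_) (sym ι-0))
∑-const c (x ∷ xs) = begin
  c + ∑ xs (λ _ → c)          ≡⟨ cong (λ s → c + s) (∑-const c xs) ⟩
  c + c * ι (length xs)       ≡⟨ solve 2 (λ c n → c :+ c :* n := c :* (con 1ℚ :+ n)) refl c (ι (length xs)) ⟩
  c * (1ℚ + ι (length xs))    ≡⟨ cong (c *_) (ι-suc (length xs)) ⟨
  c * ι (suc (length xs))     ∎
  where open ≡-Reasoning

∑-++ : ∀ (f : A → ℚ) xs ys → ∑ (xs ++ ys) f ≡ ∑ xs f + ∑ ys f
∑-++ f []       ys = sym (+-identityˡ (∑ ys f))
∑-++ f (x ∷ xs) ys = trans (cong (λ s → f x + s) (∑-++ f xs ys)) (sym (+-assoc (f x) (∑ xs f) (∑ ys f)))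

∑-map : ∀ (f : B → ℚ) (g : A → B) xs → ∑ (map g xs) f ≡ ∑ xs (f ∘ g)
∑-map f g []       = refl
∑-map f g (x ∷ xs) = cong (λ s → f (g x) + s) (∑-map f g xs)

∑-↭ : ∀ {xs ys : List A} (f : A → ℚ) → xs ↭ ys → ∑ xs f ≡ ∑ ys f
∑-↭ f ↭.refl        = refl
∑-↭ f (↭.prep x p)  = cong (λ s → f x + s) (∑-↭ f p)
∑-↭ f (↭.swap {xs} {ys} x y p) = trans (cong (λ s → f x + (f y + s)) (∑-↭ f p))
  (solve 3 (λ a b c → a :+ (b :+ c) := b :+ (a :+ c)) refl (f x) (f y) (∑ ys f))
∑-↭ f (↭.trans p q) = trans (∑-↭ f p) (∑-↭ f q)

∑-cartesianProduct : ∀ (f : A × B → ℚ) xs ys →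
  ∑ (cartesianProduct xs ys) f ≡ ∑ xs (λ x → ∑ ys (λ y → f (x , y)))
∑-cartesianProduct f []       ys = refl
∑-cartesianProduct f (x ∷ xs) ys = trans (∑-++ f (map (x ,_) ys) (cartesianProduct xs ys))
  (cong₂ _+_ (∑-map f (x ,_) ys) (∑-cartesianProduct f xs ys))

ι-length-filter : ∀ {P : Pred A ℓ} (P? : Decidable₁ P) xs →
  ι (length (filter P? xs)) ≡ ∑ xs (λ x → 𝟙 (P? x))
ι-length-filter P? []       = ι-0
ι-length-filter P? (x ∷ xs) with does (P? x)
... | true  = trans (ι-suc (length (filter P? xs))) (cong (λ s → 1ℚ + s) (ι-length-filter P? xs))
... | false = trans (ι-length-filter P? xs) (sym (+-identityˡ _))

module Mean {A : Set} (xs : List A) {{nonEmpty : ℕ.NonZero (length xs)}} where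

  weight : ℚ
  weight = + 1 / length xs

  weight-nonNeg : NonNegative weight
  weight-nonNeg = normalize-nonNeg 1 (length xs)

  mean : (A → ℚ) → ℚ
  mean f = weight * ∑ xs f

  mean-mono : ∀ {f g} → (∀ {x} → x ∈ xs → f x ≤ g x) → mean f ≤ mean g
  mean-mono f≤g = *-monoˡ-≤-nonNeg weight {{weight-nonNeg}} (∑-mono xs f≤g)

  mean-cong : ∀ {f g} → (∀ {x} → x ∈ xs → f x ≡ g x) → mean f ≡ mean g
  mean-cong f≡g = cong (weight *_) (∑-cong xs f≡g)

  mean-+ : ∀ f g → mean (λ x → f x + g x) ≡ mean f + mean g
  mean-+ f g = trans (cong (weight *_) (∑-+ f g xs)) (*-distribˡ-+ weight (∑ xs f) (∑ xs g))

  mean-*ˡ : ∀ c f → mean (λ x → c * f x) ≡ c * mean f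
  mean-*ˡ c f = trans (cong (weight *_) (∑-*ˡ c f xs))
    (solve 3 (λ w c s → w :* (c :* s) := c :* (w :* s)) refl weight c (∑ xs f))

  mean-*ʳ : ∀ c f → mean (λ x → f x * c) ≡ mean f * c
  mean-*ʳ c f = trans (cong (weight *_) (∑-cong xs λ {x} _ → *-comm (f x) c))
    (trans (mean-*ˡ c f) (*-comm c (mean f)))

  mean-const : ∀ c → mean (λ _ → c) ≡ c
  mean-const c = begin
    weight * ∑ xs (λ _ → c)        ≡⟨ cong (weight *_) (∑-const c xs) ⟩
    weight * (c * ι (length xs))   ≡⟨ solve 3 (λ w c n → w :* (c :* n) := c :* (w :* n)) refl
                                        weight c (ι (length xs)) ⟩
    c * (weight * ι (length xs))   ≡⟨ cong (c *_) (trans (/-*-ι 1 (length xs)) ι-1) ⟩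
    c * 1ℚ                         ≡⟨ *-identityʳ c ⟩
    c                              ∎
    where open ≡-Reasoning

  -- With all but one endpoint fixed, the edge bounds below are affine in two indicators; this
  -- evaluates their iterated means one variable at a time.
  mean-affine : ∀ k p q f g →
    mean (λ x → k + p * f x + q * g x) ≡ k + p * mean f + q * mean g
  mean-affine k p q f g = begin
    mean (λ x → k + p * f x + q * g x)
      ≡⟨ mean-+ (λ x → k + p * f x) (λ x → q * g x) ⟩
    mean (λ x → k + p * f x) + mean (λ x → q * g x)
      ≡⟨ cong₂ _+_ (mean-+ (λ _ → k) (λ x → p * f x)) (mean-*ˡ q g) ⟩
    mean (λ _ → k) + mean (λ x → p * f x) + q * mean g
      ≡⟨ cong (_+ q * mean g) (cong₂ _+_ (mean-const k) (mean-*ˡ p f)) ⟩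
    k + p * mean f + q * mean g ∎
    where open ≡-Reasoning

  0≤mean : ∀ {f} → (∀ {x} → x ∈ xs → 0ℚ ≤ f x) → 0ℚ ≤ mean f
  0≤mean {f} 0≤f = subst (_≤ mean f) (mean-const 0ℚ) (mean-mono 0≤f)

  mean≤ : ∀ {f c} → (∀ {x} → x ∈ xs → f x ≤ c) → mean f ≤ c
  mean≤ {f} {c} f≤c = subst (mean f ≤_) (mean-const c) (mean-mono f≤c)

-- Moves a mean over a part, listed by filtering all vertices, to an enumeration of that part. The
-- weights agree because permutations preserve length.
mean-↭ : ∀ {xs : List A} {ys : List B} {{_ : ℕ.NonZero (length xs)}} {{_ : ℕ.NonZero (length ys)}}
  (g : B → A) (f : A → ℚ) → xs ↭ map g ys → Mean.mean xs f ≡ Mean.mean ys (f ∘ g)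
mean-↭ {xs = xs} {ys} g f p = cong₂ _*_
  (/-cong {+ 1} {length xs} {+ 1} {length ys} refl (trans (↭-length p) (length-map g ys)))
  (trans (∑-↭ f p) (∑-map f g ys))

-- Inequalities between indicators

0≤𝟙 : (P? : Dec P) → 0ℚ ≤ 𝟙 P?
0≤𝟙 (yes _) = nonNegative⁻¹ 1ℚ
0≤𝟙 (no  _) = ≤-refl

𝟙≤1 : (P? : Dec P) → 𝟙 P? ≤ 1ℚ
𝟙≤1 (yes _) = ≤-refl
𝟙≤1 (no  _) = nonNegative⁻¹ 1ℚ

𝟙*𝟙≡0 : (P? : Dec P) (Q? : Dec Q) → ¬ (P × Q) → 𝟙 P? * 𝟙 Q? ≡ 0ℚ
𝟙*𝟙≡0 (yes p) (yes q) ¬pq = contradiction (p , q) ¬pq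
𝟙*𝟙≡0 (yes _) (no  _) _   = *-zeroʳ 1ℚ
𝟙*𝟙≡0 (no  _) Q?      _   = *-zeroˡ (𝟙 Q?)

𝟙-mono : (P? : Dec P) (Q? : Dec Q) → (P → Q) → 𝟙 P? ≤ 𝟙 Q?
𝟙-mono (yes p) (yes _) _   = ≤-refl
𝟙-mono (yes p) (no ¬q) p⇒q = contradiction (p⇒q p) ¬q
𝟙-mono (no  _) Q?      _   = 0≤𝟙 Q?

-- Meant for two non-apex parts of the extremal graph: `P` and `Q` say that the endpoints are low,
-- `R` that they are adjacent. The zero term gives the left side the shape of `mean-affine`.
1-𝟙*𝟙≤𝟙 : (P? : Dec P) (Q? : Dec Q) (R? : Dec R) → (¬ (P × Q) → R) →
  1ℚ + (- 𝟙 P?) * 𝟙 Q? + 0ℚ * 𝟙 Q? ≤ 𝟙 R?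
1-𝟙*𝟙≤𝟙 (yes _) (yes _) R?  _ = 0≤𝟙 R?
1-𝟙*𝟙≤𝟙 P? Q? (yes _) _ = ≤-gap (0≤*0≤ (0≤𝟙 P?) (0≤𝟙 Q?))
  (solve 2 (λ p q → con 1ℚ :+ (:- p) :* q :+ con 0ℚ :* q :+ p :* q := con 1ℚ) refl (𝟙 P?) (𝟙 Q?))
1-𝟙*𝟙≤𝟙 (no ¬p) _       (no ¬r) h = contradiction (h (¬p ∘ proj₁)) ¬r
1-𝟙*𝟙≤𝟙 (yes _) (no ¬q) (no ¬r) h = contradiction (h (¬q ∘ proj₂)) ¬r

-- [P×Q ∪ P′×Q′] ≥ [P×Q] + [P′×Q′] - [P′×Q], with one minus the right side written
-- as an affine function of [Q] and [Q′].
𝟙-disjoint-products : ∀ {ℓ} {P Q P′ Q′ R : Set ℓ}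
  (P? : Dec P) (Q? : Dec Q) (P′? : Dec P′) (Q′? : Dec Q′) (R? : Dec R) →
  (R → ¬ (P × Q)) → (R → ¬ (P′ × Q′)) →
  𝟙 R? ≤ 1ℚ + (𝟙 P′? - 𝟙 P?) * 𝟙 Q? + (- 𝟙 P′?) * 𝟙 Q′?
𝟙-disjoint-products P? Q? P′? Q′? (yes r) ¬pq ¬p′q′ =
  ≤-gap (0≤*0≤ (0≤𝟙 P′?) (0≤𝟙 Q?)) (trans
    (sym (trans
      (cong₂ (λ s t → 1ℚ + 𝟙 P′? * 𝟙 Q? - s - t)
        (𝟙*𝟙≡0 P? Q? (¬pq r)) (𝟙*𝟙≡0 P′? Q′? (¬p′q′ r)))
      (solve 1 (λ s → con 1ℚ :+ s :- con 0ℚ :- con 0ℚ := con 1ℚ :+ s) refl (𝟙 P′? * 𝟙 Q?))))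
    (solve 4 (λ x y x′ y′ → con 1ℚ :+ x′ :* y :- x :* y :- x′ :* y′
                := con 1ℚ :+ (x′ :- x) :* y :+ (:- x′) :* y′)
      refl (𝟙 P?) (𝟙 Q?) (𝟙 P′?) (𝟙 Q′?)))
-- Here the right side must be nonnegative. Being affine in x′ = [P′], it is the combination of its
-- values at x′ = 0 and x′ = 1 with weights 1 - x′ and x′; both values are sums of nonnegative
-- terms.
𝟙-disjoint-products P? Q? P′? Q′? (no _) _ _ = subst (0ℚ ≤_)
  (solve 4 (λ x y x′ y′ →
      (con 1ℚ :- x′) :* ((con 1ℚ :- x) :* y :+ (con 1ℚ :- y))
      :+ x′ :* ((con 1ℚ :- y′) :+ y :* (con 1ℚ :- x))
      := con 1ℚ :+ (x′ :- x) :* y :+ (:- x′) :* y′)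
    refl (𝟙 P?) (𝟙 Q?) (𝟙 P′?) (𝟙 Q′?))
  (+-mono-≤
    (0≤*0≤ (0≤1-𝟙 P′?) (+-mono-≤ (0≤*0≤ (0≤1-𝟙 P?) (0≤𝟙 Q?)) (0≤1-𝟙 Q?)))
    (0≤*0≤ (0≤𝟙 P′?) (+-mono-≤ (0≤1-𝟙 Q′?) (0≤*0≤ (0≤𝟙 Q?) (0≤1-𝟙 P?)))))
  where
  0≤1-𝟙 : ∀ {ℓ} {P : Set ℓ} (P? : Dec P) → 0ℚ ≤ 1ℚ - 𝟙 P?
  0≤1-𝟙 P? = p≤q⇒0≤q-p (𝟙≤1 P?)

-- Triangles in dense tripartite graphs

-- If both means were positive then, with f⁺ = f [f > 0] and g⁺ = g [g > 0],
--   mean f⁺ > - mean (f [g > 0]) ≥ 0  and  mean g⁺ > - mean (g [f > 0]) ≥ 0.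
-- Multiplying these contradicts the average of the second hypothesis over i and j.
means-not-both-positive : (xs : List A) {{_ : ℕ.NonZero (length xs)}} (f g : A → ℚ)
  (f>0? : ∀ i → Dec (0ℚ < f i)) (g>0? : ∀ i → Dec (0ℚ < g i)) →
  let open Mean xs using (mean) in
  (∀ {i} → i ∈ xs → 0ℚ < f i → g i ≤ 0ℚ) →
  (∀ {i j} → i ∈ xs → j ∈ xs → 0ℚ < f i → 0ℚ < g j → f i * g j ≤ g i * f j) →
  0ℚ < mean f → 0ℚ < mean g → ⊥
means-not-both-positive {A} xs f g f>0? g>0? exclusive cross 0<mf 0<mg =
  <-irrefl refl (<-≤-trans 0<UV-SW (≤-trans (+-monoˡ-≤ (- (S * W)) UV≤SW)
    (≤-reflexive (+-inverseʳ (S * W)))))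
  where
  open Mean xs
  -- `u` is f⁺ and `v` is g⁺; a prime marks restriction to the points where the other function is
  -- positive.
  u v g′ f′ : A → ℚ
  u i  = f i when f>0? i
  v i  = g i when g>0? i
  g′ i = g i when f>0? i
  f′ i = f i when g>0? i

  U V S W : ℚ
  U = mean u
  V = mean v
  S = mean g′
  W = mean f′

  uv≤g′f′ : ∀ {i j} → i ∈ xs → j ∈ xs → u i * v j ≤ g′ i * f′ j
  uv≤g′f′ {i} {j} i∈ j∈ with f>0? i | g>0? j
  ... | yes fi | yes gj = cross i∈ j∈ fi gj
  ... | yes _  | no  _  = ≤-reflexive (trans (*-zeroʳ (f i)) (sym (*-zeroʳ (g i))))
  ... | no  _  | yes _  = ≤-reflexive (trans (*-zeroˡ (g j)) (sym (*-zeroˡ (f j))))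
  ... | no  _  | no  _  = ≤-refl

  UV≤SW : U * V ≤ S * W
  UV≤SW = subst₂ _≤_ (mean-*ʳ V u) (mean-*ʳ W g′) (mean-mono λ {i} i∈ →
    subst₂ _≤_ (mean-*ˡ (u i) v) (mean-*ˡ (g′ i) f′) (mean-mono (uv≤g′f′ i∈)))

  f≤u+f′ : ∀ {i} → i ∈ xs → f i ≤ u i + f′ i
  f≤u+f′ {i} _ with f>0? i | g>0? i
  ... | yes fi | yes _ = ≤-gap (<⇒≤ fi) refl
  ... | yes _  | no  _ = ≤-reflexive (sym (+-identityʳ (f i)))
  ... | no  _  | yes _ = ≤-reflexive (sym (+-identityˡ (f i)))
  ... | no  f≯0 | no  _ = ≮⇒≥ f≯0

  g≤v+g′ : ∀ {i} → i ∈ xs → g i ≤ v i + g′ i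
  g≤v+g′ {i} _ with f>0? i | g>0? i
  ... | yes _ | yes gi = ≤-gap (<⇒≤ gi) refl
  ... | yes _ | no  _  = ≤-reflexive (sym (+-identityˡ (g i)))
  ... | no  _ | yes _  = ≤-reflexive (sym (+-identityʳ (g i)))
  ... | no  _ | no g≯0 = ≮⇒≥ g≯0

  W≤0 : W ≤ 0ℚ
  W≤0 = mean≤ lemma where
    lemma : ∀ {i} → i ∈ xs → f′ i ≤ 0ℚ
    lemma {i} i∈ with g>0? i
    ... | yes gi = ≮⇒≥ (λ fi → <-irrefl refl (<-≤-trans gi (exclusive i∈ fi)))
    ... | no  _  = ≤-refl

  S≤0 : S ≤ 0ℚ
  S≤0 = mean≤ lemma where
    lemma : ∀ {i} → i ∈ xs → g′ i ≤ 0ℚ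
    lemma {i} i∈ with f>0? i
    ... | yes fi = exclusive i∈ fi
    ... | no  _  = ≤-refl

  0<U+W : 0ℚ < U + W
  0<U+W = <-≤-trans 0<mf (subst (mean f ≤_) (mean-+ u f′) (mean-mono f≤u+f′))

  0<V+S : 0ℚ < V + S
  0<V+S = <-≤-trans 0<mg (subst (mean g ≤_) (mean-+ v g′) (mean-mono g≤v+g′))

  0<V : 0ℚ < V
  0<V = <-≤-trans 0<V+S (subst (V + S ≤_) (+-identityʳ V) (+-monoʳ-≤ V S≤0))

  -- The inequalities U > -W and V > -S are multiplied in two steps: the first by `V`, positive
  -- since S ≤ 0, the second by `- W`, nonnegative.
  0<UV-SW : 0ℚ < U * V - S * W
  0<UV-SW = subst (0ℚ <_)
    (solve 4 (λ U V S W → (U :+ W) :* V :+ (:- W) :* (V :+ S) := U :* V :- S :* W) refl U V S W)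
    (+-mono-<-≤ (0<*0< 0<U+W 0<V) (0≤*0≤ (neg-antimono-≤ W≤0) (<⇒≤ 0<V+S)))

-- Writing f = X - δ and g = Y - δ, the last hypothesis at i = j says that f and g
-- are never both nonnegative, and  perturbation  bounds f i * g j by g i * f j.
means-not-both-above : ∀ {δ} → 0ℚ < δ → δ < 1ℚ → 1ℚ ≤ δ * δ + δ →
  (xs : List A) {{_ : ℕ.NonZero (length xs)}} (X Y : A → ℚ) →
  let open Mean xs using (mean) in
  (∀ i → 0ℚ ≤ X i) → (∀ i → X i ≤ 1ℚ) → (∀ i → 0ℚ ≤ Y i) → (∀ i → Y i ≤ 1ℚ) →
  (∀ {i j} → i ∈ xs → j ∈ xs → X i * Y i + X j * Y j - X j * Y i < δ * δ) →
  δ < mean X → δ < mean Y → ⊥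
means-not-both-above {A} {δ} 0<δ δ<1 golden xs X Y 0≤X X≤1 0≤Y Y≤1 bound δ<mX δ<mY =
  means-not-both-positive xs f g (λ i → 0ℚ <? f i) (λ i → 0ℚ <? g i)
    exclusive cross (positive-mean X δ<mX) (positive-mean Y δ<mY)
  where
  open Mean xs
  f g : A → ℚ
  f i = X i - δ
  g i = Y i - δ

  positive-mean : ∀ Z → δ < mean Z → 0ℚ < mean (λ i → Z i - δ)
  positive-mean Z δ<mZ = subst (0ℚ <_)
    (sym (trans (mean-+ Z (λ _ → - δ)) (cong (λ s → mean Z + s) (mean-const (- δ)))))
    (p<q⇒0<q-p δ<mZ)

  exclusive : ∀ {i} → i ∈ xs → 0ℚ < f i → g i ≤ 0ℚ
  exclusive {i} i∈ 0<fi = ≮⇒≥ λ 0<gi → <-irrefl refl (<-≤-trans (bound i∈ i∈) (≤-gap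
    (+-mono-≤ (0≤*0≤ (<⇒≤ 0<fi) (0≤Y i)) (0≤*0≤ (<⇒≤ 0<δ) (<⇒≤ 0<gi)))
    (solve 3 (λ δ x y → δ :* δ :+ ((x :- δ) :* y :+ δ :* (y :- δ))
                 := x :* y :+ x :* y :- x :* y) refl δ (X i) (Y i))))

  cross : ∀ {i j} → i ∈ xs → j ∈ xs → 0ℚ < f i → 0ℚ < g j → f i * g j ≤ g i * f j
  -- `perturbation` is applied with a = `f i`, b = `g j`, c = `- f j`, e = `- g i`. Exclusivity
  -- makes c and e nonnegative, and the negated conclusion says c e < a b.
  cross {i} {j} i∈ j∈ 0<fi 0<gj = ≮⇒≥ λ gf<fg →
    <-irrefl refl (<-≤-trans (bound i∈ j∈) (≤-gap
      (perturbation 0<δ δ<1 golden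
        (<⇒≤ 0<fi) (+-monoˡ-≤ (- δ) (X≤1 i))
        (<⇒≤ 0<gj) (+-monoˡ-≤ (- δ) (Y≤1 j))
        (p≤q⇒0≤q-p xj≤δ) (δ-z≤δ (0≤X j))
        (p≤q⇒0≤q-p yi≤δ) (δ-z≤δ (0≤Y i))
        (<⇒≤ (subst (_< f i * g j)
          (solve 3 (λ δ x y → (y :- δ) :* (x :- δ) := (δ :- x) :* (δ :- y)) refl δ (X j) (Y i))
          gf<fg)))
      (solve 5 (λ δ x y x′ y′ →
          δ :* δ :+ ((x :- δ) :* (δ :- (δ :- y)) :+ (y′ :- δ) :* (δ :- (δ :- x′))
                     :- (δ :- x′) :* (δ :- y))
          := x :* y :+ x′ :* y′ :- x′ :* y) refl δ (X i) (Y i) (X j) (Y j))))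
    where
    δ-z≤δ : ∀ {z} → 0ℚ ≤ z → δ - z ≤ δ
    δ-z≤δ {z} 0≤z = ≤-gap 0≤z (solve 2 (λ δ z → δ :- z :+ z := δ) refl δ z)
    p-δ≤0⇒p≤δ : ∀ {p} → p - δ ≤ 0ℚ → p ≤ δ
    p-δ≤0⇒p≤δ {p} h = subst₂ _≤_
      (solve 2 (λ p δ → p :- δ :+ δ := p) refl p δ) (+-identityˡ δ) (+-monoˡ-≤ δ h)
    xj≤δ : X j ≤ δ
    xj≤δ = p-δ≤0⇒p≤δ (≮⇒≥ λ 0<fj → <-irrefl refl (<-≤-trans 0<gj (exclusive j∈ 0<fj)))
    yi≤δ : Y i ≤ δ
    yi≤δ = p-δ≤0⇒p≤δ (exclusive i∈ 0<fi)

module Tripartite {V : Set} {_~_ : Rel V 0ℓ} (_~?_ : Decidable _~_) where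

  -- An iterated mean rather than a quotient, so that bounds between indicators average to bounds
  -- between densities.
  density : (xs ys : List V) {{_ : ℕ.NonZero (length xs)}} {{_ : ℕ.NonZero (length ys)}} → ℚ
  density xs ys = mean xs λ x → mean ys λ y → 𝟙 (x ~? y)
    where open Mean

  -- The double sum of indicators is the edge count, hence the quotient times the number of pairs,
  -- which the two weights cancel.
  edges/pairs≡density : (xs ys : List V)
    {{_ : ℕ.NonZero (length xs)}} {{_ : ℕ.NonZero (length ys)}}
    .{{_ : ℕ.NonZero (length xs ℕ.* length ys)}} →
    + length (filter (uncurry _~?_) (cartesianProduct xs ys)) / (length xs ℕ.* length ys)
      ≡ density xs ys
  edges/pairs≡density xs ys = sym (begin
    density xs ys
      ≡⟨ cong (wx *_) (∑-*ˡ wy (λ x → ∑ ys λ y → 𝟙 (x ~? y)) xs) ⟩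
    wx * (wy * ∑ xs λ x → ∑ ys λ y → 𝟙 (x ~? y))
      ≡⟨ cong (λ s → wx * (wy * s)) (begin
           ∑ xs (λ x → ∑ ys λ y → 𝟙 (x ~? y))
             ≡⟨ ∑-cartesianProduct (λ (x , y) → 𝟙 (x ~? y)) xs ys ⟨
           ∑ (cartesianProduct xs ys) (λ (x , y) → 𝟙 (x ~? y))
             ≡⟨ ι-length-filter (uncurry _~?_) (cartesianProduct xs ys) ⟨
           ι E
             ≡⟨ /-*-ι E (length xs ℕ.* length ys) ⟨
           D * ι (length xs ℕ.* length ys)
             ≡⟨ cong (D *_) (ι-* (length xs) (length ys)) ⟩
           D * (ι (length xs) * ι (length ys)) ∎) ⟩
    wx * (wy * (D * (ι (length xs) * ι (length ys))))
      ≡⟨ solve 5 (λ v w d m n → v :* (w :* (d :* (m :* n))) := d :* ((v :* m) :* (w :* n)))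
           refl wx wy D (ι (length xs)) (ι (length ys)) ⟩
    D * ((wx * ι (length xs)) * (wy * ι (length ys)))
      ≡⟨ cong (D *_) (cong₂ _*_ (trans (/-*-ι 1 (length xs)) ι-1) (trans (/-*-ι 1 (length ys)) ι-1)) ⟩
    D * (1ℚ * 1ℚ)
      ≡⟨ solve 1 (λ d → d :* (con 1ℚ :* con 1ℚ) := d) refl D ⟩
    D ∎)
    where
    open ≡-Reasoning
    wx = Mean.weight xs
    wy = Mean.weight ys
    E = length (filter (uncurry _~?_) (cartesianProduct xs ys))
    D = + E / (length xs ℕ.* length ys)

  dense⇒¬triangle-free : ∀ {δ} → 0ℚ < δ → 1ℚ ≤ δ * δ + δ → (A B C : List V)
    {{_ : ℕ.NonZero (length A)}} {{_ : ℕ.NonZero (length B)}} {{_ : ℕ.NonZero (length C)}} →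
    δ < density A B → δ < density A C → δ < density B C →
    ¬ (∀ {a b c} → a ∈ A → b ∈ B → c ∈ C → a ~ b → a ~ c → ¬ b ~ c)
  dense⇒¬triangle-free {δ} 0<δ golden A B C δ<AB δ<AC δ<BC triangle-free =
    means-not-both-above 0<δ δ<1 golden A X Y
      (λ i → MB.0≤mean λ {b} _ → 0≤𝟙 (i ~? b)) (λ i → MB.mean≤ λ {b} _ → 𝟙≤1 (i ~? b))
      (λ i → MC.0≤mean λ {c} _ → 0≤𝟙 (i ~? c)) (λ i → MC.mean≤ λ {c} _ → 𝟙≤1 (i ~? c))
      bound δ<AB δ<AC
    where
    module MB = Mean B
    module MC = Mean C

    X Y : V → ℚ
    X i = MB.mean λ b → 𝟙 (i ~? b)
    Y i = MC.mean λ c → 𝟙 (i ~? c)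

    δ<1 : δ < 1ℚ
    δ<1 = <-≤-trans δ<BC (MB.mean≤ λ {b} _ → MC.mean≤ λ {c} _ → 𝟙≤1 (b ~? c))

    edge-bound : ∀ {i j b c} → i ∈ A → j ∈ A → b ∈ B → c ∈ C →
      𝟙 (b ~? c) ≤ 1ℚ + (𝟙 (j ~? b) - 𝟙 (i ~? b)) * 𝟙 (i ~? c) + (- 𝟙 (j ~? b)) * 𝟙 (j ~? c)
    edge-bound {i} {j} {b} {c} i∈ j∈ b∈ c∈ =
      𝟙-disjoint-products (i ~? b) (i ~? c) (j ~? b) (j ~? c) (b ~? c)
        (λ b~c (i~b , i~c) → triangle-free i∈ b∈ c∈ i~b i~c b~c)
        (λ b~c (j~b , j~c) → triangle-free j∈ b∈ c∈ j~b j~c b~c)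

    BC-bound : ∀ {i j} → i ∈ A → j ∈ A →
      density B C ≤ 1ℚ + (- Y i) * X i + (Y i - Y j) * X j
    BC-bound {i} {j} i∈ j∈ = subst (density B C ≤_)
      -- The mean over `c` turns the indicators of `i ~ c` and `j ~ c` into `Y i` and `Y j`.
      -- Regrouping makes the result affine in those of `i ~ b` and `j ~ b`, ready for the mean over
      -- `b`.
      (trans (MB.mean-cong λ {b} _ → trans
          (MC.mean-affine 1ℚ (𝟙 (j ~? b) - 𝟙 (i ~? b)) (- 𝟙 (j ~? b))
            (λ c → 𝟙 (i ~? c)) (λ c → 𝟙 (j ~? c)))
          (solve 4 (λ x x′ y y′ → con 1ℚ :+ (x′ :- x) :* y :+ (:- x′) :* y′
                      := con 1ℚ :+ (:- y) :* x :+ (y :- y′) :* x′)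
            refl (𝟙 (i ~? b)) (𝟙 (j ~? b)) (Y i) (Y j)))
        (MB.mean-affine 1ℚ (- Y i) (Y i - Y j) (λ b → 𝟙 (i ~? b)) (λ b → 𝟙 (j ~? b))))
      (MB.mean-mono λ b∈ → MC.mean-mono λ c∈ → edge-bound i∈ j∈ b∈ c∈)

    bound : ∀ {i j} → i ∈ A → j ∈ A → X i * Y i + X j * Y j - X j * Y i < δ * δ
    bound {i} {j} i∈ j∈ = 0<q-p⇒p<q (<-≤-trans (p<q⇒0<q-p δ<BC) (≤-gap
      (+-mono-≤ (p≤q⇒0≤q-p (BC-bound i∈ j∈)) (p≤q⇒0≤q-p golden))
      (solve 6 (λ d e x y x′ y′ →
          e :- d :+ (con 1ℚ :+ (:- y) :* x :+ (y :- y′) :* x′ :- e :+ (d :* d :+ d :- con 1ℚ))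
          := d :* d :- (x :* y :+ x′ :* y′ :- x′ :* y))
        refl δ (density B C) (X i) (Y i) (X j) (Y j))))

-- Disjoint triangles through all parts of a dense graph

module _ (G : PartiteGraph m) where
  open PartiteGraph G
  open Tripartite _~?_

  density≡d : ∀ i j → density (V i) (V j) ≡ d i j
  density≡d i j = sym (edges/pairs≡density (V i) (V j))
    where instance _ = ℕ.m*n≢0 ∣V i ∣ ∣V j ∣

  minDensity≤d : ∀ {i j} → i Fin.< j → minDensity ≤ d i j
  minDensity≤d {i} {j} i<j = All.lookup (min≤xs 1ℚ _)
    (∈-map⁺ (uncurry d) (∈-filter⁺ (uncurry Fin._<?_)
      (∈-cartesianProduct⁺ (∈-allFin i) (∈-allFin j)) i<j))
    where open Extrema (DecTotalOrder.totalOrder ≤-decTotalOrder) using (min≤xs)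

  Triangle : Fin m → Fin m → Fin m → Set
  Triangle i j k = ∃ λ a → ∃ λ b → ∃ λ c →
    (part a ≡ i × part b ≡ j × part c ≡ k) × (a ~ b × a ~ c × b ~ c)

  -- Decidability lets the argument by contradiction in `dense⇒triangle` deliver an actual triangle.
  triangle? : ∀ i j k → Dec (Triangle i j k)
  triangle? i j k = Fin.any? λ a → Fin.any? λ b → Fin.any? λ c →
    ((part a Fin.≟ i) ×-dec ((part b Fin.≟ j) ×-dec (part c Fin.≟ k)))
    ×-dec ((a ~? b) ×-dec ((a ~? c) ×-dec (b ~? c)))

  dense⇒triangle : ∀ {δ} → 0ℚ < δ → 1ℚ ≤ δ * δ + δ → δ < minDensity →
    ∀ {i j k} → i Fin.< j → j Fin.< k → Triangle i j k
  dense⇒triangle {δ} 0<δ golden δ<min {i} {j} {k} i<j j<k =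
    decidable-stable (triangle? i j k) λ ¬t →
      dense⇒¬triangle-free 0<δ golden (V i) (V j) (V k)
        (above i<j) (above (Fin.<-trans i<j j<k)) (above j<k)
        λ {a} {b} {c} a∈ b∈ c∈ a~b a~c b~c →
          ¬t (a , b , c , (part≡ a∈ , part≡ b∈ , part≡ c∈) , (a~b , a~c , b~c))
    where
    part≡ : ∀ {v l} → v ∈ V l → part v ≡ l
    part≡ {l = l} v∈ = proj₂ (∈-filter⁻ (λ v → part v Fin.≟ l) {xs = allFin order} v∈)
    above : ∀ {i j} → i Fin.< j → δ < density (V i) (V j)
    above {i} {j} i<j = <-≤-trans δ<min
      (subst (minDensity ≤_) (sym (density≡d i j)) (minDensity≤d i<j))

  -- Copy k takes its triangle from the parts 3k, 3k + 1, 3k + 2, so vertex `x` of `r · K 3` lands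
  -- in part `x`. This gives both injectivity and one vertex per part, with `r · K 3` itself as the
  -- traversal.
  triangles⇒r·K₃ : ∀ {r} → m ≡ r ℕ.* 3 →
    (∀ {i j k} → i Fin.< j → j Fin.< k → Triangle i j k) → HasTraversal (r · K 3) G
  triangles⇒r·K₃ {r} refl triangle =
    record { subgraph = r · K 3 ; embed = embed ; one-each = one-each } ,
    record { ⟦_⟧ = id ; injective = id ; edge = id }
    where
    t : (k : Fin r) → Triangle (combine k zero) (combine k (suc zero)) (combine k (suc (suc zero)))
    t k = triangle
      (combine-monoʳ-< k (ℕ.s≤s ℕ.z≤n)) (combine-monoʳ-< k (ℕ.s≤s (ℕ.s≤s ℕ.z≤n)))
      where
      combine-monoʳ-< : ∀ (k : Fin r) {s t : Fin 3} → s Fin.< t → combine k s Fin.< combine k t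
      combine-monoʳ-< k {s} {t} s<t = subst₂ ℕ._<_
        (sym (Fin.toℕ-combine k s)) (sym (Fin.toℕ-combine k t)) (ℕ.+-monoʳ-< (3 ℕ.* Fin.toℕ k) s<t)

    corner : Fin r → Fin 3 → Vertex
    corner k s with t k | s
    ... | a , _ , _ , _ | zero         = a
    ... | _ , b , _ , _ | suc zero     = b
    ... | _ , _ , c , _ | suc (suc _)  = c

    part-corner : ∀ k s → part (corner k s) ≡ combine k s
    part-corner k s with t k | s
    ... | _ , _ , _ , (pa , _ , _) , _ | zero           = pa
    ... | _ , _ , _ , (_ , pb , _) , _ | suc zero       = pb
    ... | _ , _ , _ , (_ , _ , pc) , _ | suc (suc zero) = pc

    corner-edge : ∀ k {s s′} → s ≢ s′ → corner k s ~ corner k s′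
    corner-edge k {s} {s′} s≢s′ with t k | s | s′
    ... | _ , _ , _ , _ , (ab , ac , bc) | zero           | zero           = contradiction refl s≢s′
    ... | _ , _ , _ , _ , (ab , ac , bc) | zero           | suc zero       = ab
    ... | _ , _ , _ , _ , (ab , ac , bc) | zero           | suc (suc zero) = ac
    ... | _ , _ , _ , _ , (ab , ac , bc) | suc zero       | zero           = ~-sym ab
    ... | _ , _ , _ , _ , (ab , ac , bc) | suc zero       | suc zero       = contradiction refl s≢s′
    ... | _ , _ , _ , _ , (ab , ac , bc) | suc zero       | suc (suc zero) = bc
    ... | _ , _ , _ , _ , (ab , ac , bc) | suc (suc zero) | zero           = ~-sym ac
    ... | _ , _ , _ , _ , (ab , ac , bc) | suc (suc zero) | suc zero       = ~-sym bc
    ... | _ , _ , _ , _ , (ab , ac , bc) | suc (suc zero) | suc (suc zero) = contradiction refl s≢s′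

    vertex : Fin m → Vertex
    vertex x = corner (quotient 3 x) (remainder {r} 3 x)

    part-vertex : ∀ x → part (vertex x) ≡ x
    part-vertex x = trans (part-corner (quotient 3 x) (remainder {r} 3 x)) (Fin.combine-remQuot {r} 3 x)

    embed : (r · K 3) ⊑ graph
    embed = record
      { ⟦_⟧       = vertex
      ; injective = λ {x} {y} eq → trans (sym (part-vertex x)) (trans (cong part eq) (part-vertex y))
      ; edge      = λ {x} {y} (k≡l , s≢s′) →
          subst (λ l → vertex x ~ corner l (remainder {r} 3 y)) k≡l (corner-edge (quotient 3 x) s≢s′)
      }

    one-each : ∀ i → _
    one-each i = i , part-vertex i , λ {y} eq → trans (sym eq) (part-vertex y)

HasTraversal-⊑ : {G : PartiteGraph m} → F ⊑ F′ → HasTraversal F′ G → HasTraversal F G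
HasTraversal-⊑ F⊑F′ (T , F′⊑T) = T , record
  { ⟦_⟧       = ⟦ F′⊑T ⟧ ∘ ⟦ F⊑F′ ⟧
  ; injective = _⊑_.injective F⊑F′ ∘ _⊑_.injective F′⊑T
  ; edge      = _⊑_.edge F′⊑T ∘ _⊑_.edge F⊑F′
  }

-- The extremal graphs

count-< : ∀ {M N} → M ℕ.≤ N → ∑ (allFin N) (λ b → 𝟙 (Fin.toℕ b ℕ.<? M)) ≡ ι M
count-< {ℕ.zero} {N} _ = trans (∑-const 0ℚ (allFin N)) (trans (*-zeroˡ (ι (length (allFin N)))) (sym ι-0))
count-< {suc M} {suc N} (ℕ.s≤s M≤N) = begin
  1ℚ + ∑ (tabulate suc) (λ (b : Fin (suc N)) → 𝟙 (Fin.toℕ b ℕ.<? suc M))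
    ≡⟨ cong (λ xs → 1ℚ + ∑ xs (λ b → 𝟙 (Fin.toℕ b ℕ.<? suc M))) (map-tabulate {n = N} id suc) ⟨
  1ℚ + ∑ (map suc (allFin N)) (λ b → 𝟙 (Fin.toℕ b ℕ.<? suc M))
    ≡⟨ cong (λ s → 1ℚ + s) (∑-map (λ b → 𝟙 (Fin.toℕ b ℕ.<? suc M)) suc (allFin N)) ⟩
  1ℚ + ∑ (allFin N) (λ b → 𝟙 (Fin.toℕ b ℕ.<? M))
    ≡⟨ cong (λ s → 1ℚ + s) (count-< M≤N) ⟩
  1ℚ + ι M
    ≡⟨ ι-suc M ⟨
  ι (suc M) ∎
  where open ≡-Reasoning

data Kind : Set where
  apex low high : Kind

compatible : Kind → Kind → Bool
compatible apex low  = true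
compatible low  apex = true
compatible low  high = true
compatible high low  = true
compatible high high = true
compatible _    _    = false

compatible-sym : ∀ k l → T (compatible k l) → T (compatible l k)
compatible-sym apex low  _ = _
compatible-sym low  apex _ = _
compatible-sym low  high _ = _
compatible-sym high low  _ = _
compatible-sym high high _ = _

-- Both neighbours of an apex must be low, and two low vertices are incompatible.
apex-in-no-triangle : ∀ {k l} → T (compatible apex k) → T (compatible apex l) → ¬ T (compatible k l)
apex-in-no-triangle {low} {low} _ _ ()

-- There are `suc m` parts of `suc n` vertices. Part zero holds the apices; in each other part the
-- vertices with index below `M` are low, so the fraction s is `M / suc n`.
module ApexGraph (m n M : ℕ) where
  N : ℕ
  N = suc n

  kindOf : Fin (suc m) → Fin N → Kind
  kindOf zero    _ = apex
  kindOf (suc _) a with Fin.toℕ a ℕ.<? M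
  ... | yes _ = low
  ... | no  _ = high

  part : Fin (suc m ℕ.* N) → Fin (suc m)
  part = quotient N

  kind : Fin (suc m ℕ.* N) → Kind
  kind x = kindOf (part x) (remainder {suc m} N x)

  graph : Graph
  graph = record
    { order = suc m ℕ.* N
    ; _~_   = λ x y → part x ≢ part y × T (compatible (kind x) (kind y))
    ; _~?_  = λ x y → ¬? (part x Fin.≟ part y) ×-dec T? (compatible (kind x) (kind y))
    ; ~-sym = λ {x} {y} (p≢q , c) → ≢-sym p≢q , compatible-sym (kind x) (kind y) c
    ; ~-irr = λ x≡y (p≢q , _) → p≢q (cong part x≡y)
    }

  open Graph graph using (_~_; _~?_)

  vertex : Fin (suc m) → Fin N → Fin (suc m ℕ.* N)
  vertex = combine

  part-vertex : ∀ i a → part (vertex i a) ≡ i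
  part-vertex i a = cong proj₁ (Fin.remQuot-combine i a)

  kind-vertex : ∀ i a → kind (vertex i a) ≡ kindOf i a
  kind-vertex i a = cong (uncurry kindOf) (Fin.remQuot-combine i a)

  partite : PartiteGraph (suc m)
  partite = record
    { graph         = graph
    ; part          = part
    ; part-nonempty = λ i → vertex i zero , part-vertex i zero
    ; part-edgeless = proj₁
    }

  open Mean (allFin N) {{ℕ.nonZero}}
  open PartiteGraph partite using (V; d; minDensity)
  open Tripartite _~?_

  -- Both lists are free of duplicates and have the same members, so they agree as bags.
  V↭ : ∀ i → V i ↭ map (vertex i) (allFin N)
  V↭ i = ∼bag⇒↭ (unique∧set⇒bag
    (Unique.filter⁺ (λ v → part v Fin.≟ i) (Unique.allFin⁺ (suc m ℕ.* N)))
    (Unique.map⁺ (λ {a} {b} → Fin.combine-injectiveʳ i a i b) (Unique.allFin⁺ N))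
    (mk⇔ to from))
    where
    to : ∀ {x} → x ∈ V i → x ∈ map (vertex i) (allFin N)
    to {x} x∈ with refl ← proj₂ (∈-filter⁻ (λ v → part v Fin.≟ i) {xs = allFin (suc m ℕ.* N)} x∈) =
      subst (_∈ map (vertex i) (allFin N)) (Fin.combine-remQuot {suc m} N x)
        (∈-map⁺ (vertex i) (∈-allFin (remainder {suc m} N x)))
    from : ∀ {x} → x ∈ map (vertex i) (allFin N) → x ∈ V i
    from x∈ with a , _ , refl ← ∈-map⁻ (vertex i) x∈ =
      ∈-filter⁺ (λ v → part v Fin.≟ i) (∈-allFin (vertex i a)) (part-vertex i a)

  density≡mean : ∀ i j → d i j ≡ mean λ a → mean λ b → 𝟙 (vertex i a ~? vertex j b)
  density≡mean i j = begin
    d i j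
      ≡⟨ density≡d partite i j ⟨
    density (V i) (V j) {{V≠∅ i}} {{V≠∅ j}}
      ≡⟨ mean-V i (λ x → Mean.mean (V j) {{V≠∅ j}} λ y → 𝟙 (x ~? y)) ⟩
    mean (λ a → Mean.mean (V j) {{V≠∅ j}} λ y → 𝟙 (vertex i a ~? y))
      ≡⟨ mean-cong (λ {a} _ → mean-V j (λ y → 𝟙 (vertex i a ~? y))) ⟩
    mean (λ a → mean λ b → 𝟙 (vertex i a ~? vertex j b)) ∎
    where
    open ≡-Reasoning
    V≠∅ : ∀ i → ℕ.NonZero (length (V i))
    V≠∅ i = PartiteGraph.∣V∣-nonZero partite {i}
    mean-V : ∀ i f → Mean.mean (V i) {{V≠∅ i}} f ≡ mean (f ∘ vertex i)
    mean-V i f = mean-↭ {{V≠∅ i}} {{ℕ.nonZero}} (vertex i) f (V↭ i)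

  low? : (a : Fin N) → Dec (Fin.toℕ a ℕ.< M)
  low? a = Fin.toℕ a ℕ.<? M

  ~-vertex : ∀ i a j b → i ≢ j → T (compatible (kindOf i a) (kindOf j b)) →
    vertex i a ~ vertex j b
  ~-vertex i a j b i≢j c =
    subst₂ _≢_ (sym (part-vertex i a)) (sym (part-vertex j b)) i≢j ,
    subst₂ (λ k l → T (compatible k l)) (sym (kind-vertex i a)) (sym (kind-vertex j b)) c

  compatible-apex : ∀ j b → Fin.toℕ b ℕ.< M → T (compatible apex (kindOf (suc j) b))
  compatible-apex j b b<M with Fin.toℕ b ℕ.<? M
  ... | yes _  = _
  ... | no b≮M = contradiction b<M b≮M

  compatible-other : ∀ i a j b → ¬ (Fin.toℕ a ℕ.< M × Fin.toℕ b ℕ.< M) →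
    T (compatible (kindOf (suc i) a) (kindOf (suc j) b))
  compatible-other i a j b ¬both with Fin.toℕ a ℕ.<? M | Fin.toℕ b ℕ.<? M
  ... | yes a<M | yes b<M = contradiction (a<M , b<M) ¬both
  ... | yes _   | no  _   = _
  ... | no  _   | yes _   = _
  ... | no  _   | no  _   = _

  module _ {s : ℚ} (s*N≡M : s * ι N ≡ ι M) (M≤N : M ℕ.≤ N) (s*s+s≤1 : s * s + s ≤ 1ℚ) where

    mean-low : mean (λ b → 𝟙 (low? b)) ≡ s
    mean-low = begin
      weight * ∑ (allFin N) (λ b → 𝟙 (low? b)) ≡⟨ cong (weight *_) (count-< M≤N) ⟩
      weight * ι M             ≡⟨ cong (weight *_) s*N≡M ⟨
      weight * (s * ι N)       ≡⟨ solve 3 (λ w s n → w :* (s :* n) := s :* (w :* n)) refl weight s (ι N) ⟩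
      s * (weight * ι N)       ≡⟨ cong (s *_) weight*N≡1 ⟩
      s * 1ℚ                   ≡⟨ *-identityʳ s ⟩
      s                        ∎
      where
      open ≡-Reasoning
      weight*N≡1 : weight * ι N ≡ 1ℚ
      weight*N≡1 = trans (cong (λ k → weight * ι k) (sym (length-tabulate {n = N} id)))
        (trans (/-*-ι 1 (length (allFin N))) ι-1)

    s≤d : ∀ {i j} → i Fin.< j → s ≤ d i j
    s≤d {zero}  {suc j} _   =
      subst₂ _≤_ (trans (mean-const _) mean-low) (sym (density≡mean zero (suc j)))
      (mean-mono λ {a} _ → mean-mono λ {b} _ →
        𝟙-mono (low? b) (vertex zero a ~? vertex (suc j) b)
          (~-vertex zero a (suc j) b (λ ()) ∘ compatible-apex j b))
    -- The double mean of 1 - [a low][b low] is 1 - s², and its excess over `s` is the slack in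
    -- `s * s + s ≤ 1ℚ`.
    s≤d {suc i} {suc j} i<j = ≤-trans
      (≤-gap (p≤q⇒0≤q-p s*s+s≤1)
        (solve 1 (λ s → s :+ (con 1ℚ :- (s :* s :+ s))
                    := con 1ℚ :+ (:- s) :* s :+ con 0ℚ :* s) refl s))
      (subst₂ _≤_ mean-1-ll (sym (density≡mean (suc i) (suc j)))
        (mean-mono λ {a} _ → mean-mono λ {b} _ →
          1-𝟙*𝟙≤𝟙 (low? a) (low? b) (vertex (suc i) a ~? vertex (suc j) b)
            (~-vertex (suc i) a (suc j) b (Fin.<⇒≢ i<j) ∘ compatible-other i a j b)))
      where
      l : Fin N → ℚ
      l a = 𝟙 (low? a)
      mean-1-ll : mean (λ a → mean λ b → 1ℚ + (- l a) * l b + 0ℚ * l b) ≡ 1ℚ + (- s) * s + 0ℚ * s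
      mean-1-ll = trans (mean-cong λ {a} _ → trans (mean-affine 1ℚ (- l a) 0ℚ l l)
          (trans (cong (λ s → 1ℚ + (- l a) * s + 0ℚ * s) mean-low)
            (solve 2 (λ x s → con 1ℚ :+ (:- x) :* s :+ con 0ℚ :* s
                         := con 1ℚ :+ (:- s) :* x :+ con 0ℚ :* x) refl (l a) s)))
        (trans (mean-affine 1ℚ (- s) 0ℚ l l) (cong (λ t → 1ℚ + (- s) * t + 0ℚ * t) mean-low))

    -- The hypothesis `s ≤ 1ℚ` covers the default value 1 of the minimum.
    s≤minDensity : s ≤ 1ℚ → s ≤ minDensity
    s≤minDensity s≤1 = v≤min⁺ s≤1 (All.map⁺ (All.map (λ {(i , j)} → s≤d {i} {j})
        (All.all-filter (uncurry Fin._<?_) (cartesianProduct (allFin (suc m)) (allFin (suc m))))))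
      where open Extrema (DecTotalOrder.totalOrder ≤-decTotalOrder) using (v≤min⁺)

  apex-triangle-free : ∀ {x y z} → part x ≡ zero → x ~ y → x ~ z → ¬ y ~ z
  apex-triangle-free {x} px≡0 (_ , xy) (_ , xz) (_ , yz)
    rewrite px≡0 = apex-in-no-triangle xy xz yz

-- If `y` were missed, deleting it with `punchOut` would inject `Fin n` into a set with fewer than n
-- elements.
injective⇒surjective : ∀ {f : Fin n → Fin m} → Injective _≡_ _≡_ f → m ℕ.≤ n → ∀ y → ∃ λ x → f x ≡ y
injective⇒surjective {n} {suc m} {f} inj m≤n y = decidable-stable (Fin.any? λ x → f x Fin.≟ y)
  λ ¬hit → ℕ.1+n≰n (ℕ.≤-trans m≤n (Fin.injective⇒≤
    {f = λ x → punchOut {i = y} {j = f x} (λ y≡fx → ¬hit (x , sym y≡fx))}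
    (λ {x} {x′} eq → inj (Fin.punchOut-injective {i = y} {f x} {f x′} _ _ eq))))

-- `r · K 3` has as many vertices as there are parts, and a traversal sends them to distinct parts,
-- so one becomes an apex. Every vertex of `r · K 3` lies in a triangle, but no apex does.
¬HasTraversal-apex : ∀ {r m n M} → suc m ≡ r ℕ.* 3 → ¬ HasTraversal (r · K 3) (ApexGraph.partite m n M)
¬HasTraversal-apex {r} {m} {n} {M} m≡ (T , F⊑T) =
  let x , px≡0 = injective⇒surjective part∘g-injective (ℕ.≤-reflexive m≡) zero
      k = quotient 3 x
      s₁ , s₂ , s≢s₁ , s≢s₂ , s₁≢s₂ = others (remainder {r} 3 x)
      y₁ = combine k s₁
      y₂ = combine k s₂
      rq₁ = Fin.remQuot-combine k s₁
      rq₂ = Fin.remQuot-combine k s₂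
      e₁ : k ≡ quotient 3 y₁ × remainder {r} 3 x ≢ remainder {r} 3 y₁
      e₁ = sym (cong proj₁ rq₁) , λ eq → s≢s₁ (trans eq (cong proj₂ rq₁))
      e₂ : k ≡ quotient 3 y₂ × remainder {r} 3 x ≢ remainder {r} 3 y₂
      e₂ = sym (cong proj₁ rq₂) , λ eq → s≢s₂ (trans eq (cong proj₂ rq₂))
      e₃ : quotient {r} 3 y₁ ≡ quotient 3 y₂ × remainder {r} 3 y₁ ≢ remainder {r} 3 y₂
      e₃ = trans (cong proj₁ rq₁) (sym (cong proj₁ rq₂)) ,
           λ eq → s₁≢s₂ (trans (sym (cong proj₂ rq₁)) (trans eq (cong proj₂ rq₂)))
  in apex-triangle-free {g x} {g y₁} {g y₂} px≡0 (g-edge x y₁ e₁) (g-edge x y₂ e₂) (g-edge y₁ y₂ e₃)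
  where
  open ApexGraph m n M
  open Traversal T
  module F = Graph (r · K 3)

  g : Fin (r ℕ.* 3) → Graph.Vertex graph
  g = ⟦ embed ⟧ ∘ ⟦ F⊑T ⟧

  g-edge : ∀ x y → x F.~ y → Graph._~_ graph (g x) (g y)
  g-edge x y = _⊑_.edge embed ∘ _⊑_.edge F⊑T

  part∘embed-injective : ∀ {u v} → part (⟦ embed ⟧ u) ≡ part (⟦ embed ⟧ v) → u ≡ v
  part∘embed-injective {u} {v} eq with _ , _ , unique ← one-each (part (⟦ embed ⟧ v)) =
    trans (sym (unique eq)) (unique refl)

  part∘g-injective : Injective _≡_ _≡_ (part ∘ g)
  part∘g-injective = _⊑_.injective F⊑T ∘ part∘embed-injective

  others : (s : Fin 3) → ∃₂ λ s₁ s₂ → s ≢ s₁ × s ≢ s₂ × s₁ ≢ s₂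
  others zero             = suc zero , suc (suc zero) , (λ ()) , (λ ()) , λ ()
  others (suc zero)       = zero , suc (suc zero) , (λ ()) , (λ ()) , λ ()
  others (suc (suc zero)) = zero , suc zero , (λ ()) , (λ ()) , λ ()

-- The critical density

-- The positive root of q² + q = 1.
1/φ : ℝ
1/φ = (- 1ℚ ⊕ √ (+ 5 / 1)) ⊘ (+ 2 / 1)

-- The cut unfolds to 2q + 1 < √5, that is, to two rational comparisons; `- - 1ℚ` is the form that
-- `_⊕_` produces.
lower-1/φ? : ∀ q → Dec (lower 1/φ q)
lower-1/φ? q = (2q+1 <? 0ℚ) ⊎-dec (2q+1 * 2q+1 <? + 5 / 1)
  where 2q+1 = q * (+ 2 / 1) - - 1ℚ

0<4 : 0ℚ < + 4 / 1
0<4 = positive⁻¹ (+ 4 / 1)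

-- Rests on (2q + 1)² - 5 = 4 (q² + q - 1), together with 2q + 1 ≥ 0 for the sign of q.
¬lower-1/φ : ∀ {q} → ¬ lower 1/φ q → 0ℚ < q × 1ℚ ≤ q * q + q
¬lower-1/φ {q} ¬l = ≰⇒> q≰0 , golden
  where
  2q+1 : ℚ
  2q+1 = q * (+ 2 / 1) - - 1ℚ
  0≤2q+1 : 0ℚ ≤ 2q+1
  0≤2q+1 = ≮⇒≥ (¬l ∘ inj₁)
  5≤[2q+1]² : + 5 / 1 ≤ 2q+1 * 2q+1
  5≤[2q+1]² = ≮⇒≥ (¬l ∘ inj₂)
  golden : 1ℚ ≤ q * q + q
  golden = ≤-gap {s = q * q + q - 1ℚ}
    (0≤*-cancelˡ 0<4 (subst (0ℚ ≤_)
      (solve 1 (λ q → let s = q :* con (+ 2 / 1) :- con (- 1ℚ) in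
          s :* s :- con (+ 5 / 1) := con (+ 4 / 1) :* (q :* q :+ q :- con 1ℚ)) refl q)
      (p≤q⇒0≤q-p 5≤[2q+1]²)))
    (solve 1 (λ q → con 1ℚ :+ (q :* q :+ q :- con 1ℚ) := q :* q :+ q) refl q)
  q≰0 : ¬ q ≤ 0ℚ
  -- For q ≤ 0 ≤ 2q + 1, the identity q² + q = q (2q + 1) - q² gives q² + q ≤ 0, against `golden`.
  q≰0 q≤0 = <-irrefl refl (<-≤-trans (positive⁻¹ 1ℚ) (≤-trans golden (≤-gap
    (+-mono-≤ (0≤*0≤ 0≤-q 0≤2q+1) (0≤*0≤ 0≤-q 0≤-q))
    (solve 1 (λ q → q :* q :+ q :+ ((:- q) :* (q :* con (+ 2 / 1) :- con (- 1ℚ)) :+ (:- q) :* (:- q))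
                 := con 0ℚ) refl q))))
    where
    0≤-q : 0ℚ ≤ - q
    0≤-q = neg-antimono-≤ q≤0

-- The witness is max(q, 0), since a negative q cannot be a density.
lower-1/φ : ∀ {q} → lower 1/φ q → ∃ λ s → q ≤ s × 0ℚ ≤ s × s * s + s ≤ 1ℚ
lower-1/φ {q} l with q ≤? 0ℚ
... | yes q≤0 = 0ℚ , q≤0 , ≤-refl , nonNegative⁻¹ 1ℚ
lower-1/φ {q} (inj₁ s<0) | no q≰0 = contradiction
  (≤-<-trans (+-mono-≤ (0≤*0≤ (<⇒≤ (≰⇒> q≰0)) (nonNegative⁻¹ (+ 2 / 1))) (nonNegative⁻¹ 1ℚ)) s<0)
  (<-irrefl refl)
lower-1/φ {q} (inj₂ ss<5) | no q≰0 = q , ≤-refl , <⇒≤ (≰⇒> q≰0) , ≤-gap {s = 1ℚ - (q * q + q)}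
  (0≤*-cancelˡ 0<4 (subst (0ℚ ≤_)
    (solve 1 (λ q → let s = q :* con (+ 2 / 1) :- con (- 1ℚ) in
        con (+ 5 / 1) :- s :* s := con (+ 4 / 1) :* (con 1ℚ :- (q :* q :+ q))) refl q)
    (p≤q⇒0≤q-p (<⇒≤ ss<5))))
  (solve 1 (λ q → q :* q :+ q :+ (con 1ℚ :- (q :* q :+ q)) := con 1ℚ) refl q)

-- The numerator and denominator of `s` become the number of low vertices and the size of a part.
fraction : ∀ {s} → 0ℚ ≤ s → s ≤ 1ℚ → ∃ λ M → ∃ λ n → s * ι (suc n) ≡ ι M × M ℕ.≤ suc n
fraction {s@(mkℚ (+ M) n _)} _ s≤1 = M , n ,
  trans (cong (_* ι (suc n)) (sym (↥p/↧p≡p s))) (/-*-ι M (suc n)) ,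
  ℤ.drop‿+≤+ (subst₂ ℤ._≤_ (ℤ.*-identityʳ (+ M)) (ℤ.*-identityˡ (+ suc n)) (drop-*≤* s≤1))
fraction {mkℚ -[1+ _ ] _ _} (*≤* ())

-- The two hypotheses isolate what depends on `F`, so that `r · K 3` and `K 3` share one argument.
critical-1/φ :
  (∀ G → (∀ {i j k} → i Fin.< j → j Fin.< k → Triangle G i j k) → HasTraversal F G) →
  (∀ n M → ¬ HasTraversal F (ApexGraph.partite m n M)) →
  π[ suc m ] F ≐ 1/φ
critical-1/φ {F} {m} triangles⇒F ¬F =
  (λ {α} → upper-bound {α}) , (λ {b} → least {b})
  where
  upper-bound : ∀ {α} → Avoidable (suc m) F α → α ≤ᵣ 1/φ
  upper-bound (_ , _ , G , α≤min , ¬FG) {q} q<α = decidable-stable (lower-1/φ? q) λ ¬l →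
    -- The rational q itself serves as δ: it lies strictly below α, hence below the minimum density.
    let 0<q , golden = ¬lower-1/φ ¬l in
    ¬FG (triangles⇒F G (dense⇒triangle G 0<q golden (α≤min q<α)))

  least : ∀ {b} → (∀ {α} → Avoidable (suc m) F α → α ≤ᵣ b) → 1/φ ≤ᵣ b
  least bound {q} q<1/φ =
    -- Roundedness leaves room for q < r ≤ s, because membership of q in the lower cut of `fromℚ s`
    -- is strict.
    let r , q<r , r<1/φ = Equivalence.to (lower-rounded 1/φ) q<1/φ
        s , r≤s , 0≤s , s*s+s≤1 = lower-1/φ r<1/φ
        s≤1 = ≤-trans (≤-gap {s = s * s} (0≤*0≤ 0≤s 0≤s) (+-comm s (s * s))) s*s+s≤1
        M , n , s*N≡M , M≤N = fraction 0≤s s≤1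
        s≤min = ApexGraph.s≤minDensity m n M s*N≡M M≤N s*s+s≤1 s≤1
    in bound {fromℚ s}
         ((λ p<0 → <-≤-trans p<0 0≤s) , (λ p<s → <-≤-trans p<s s≤1) ,
          ApexGraph.partite m n M , (λ p<s → <-≤-trans p<s s≤min) , ¬F n M)
         (<-≤-trans q<r r≤s)

-- `1 · K 3` and `K 3` are isomorphic but not equal as records; embeddings both ways transfer the
-- case r = 1 to `K 3`.
K₃⊑1·K₃ : K 3 ⊑ (1 · K 3)
K₃⊑1·K₃ = record
  { ⟦_⟧       = id
  ; injective = id
  ; edge      = λ {u} {v} u≢v → copy≡ u v , λ eq → u≢v (trans (sym (vertex≡ u)) (trans eq (vertex≡ v)))
  }
  where
  copy≡ : ∀ u v → Fin.quotient {1} 3 u ≡ Fin.quotient 3 v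
  copy≡ u v with zero ← Fin.quotient {1} 3 u | zero ← Fin.quotient {1} 3 v = refl
  vertex≡ : ∀ u → Fin.remainder {1} 3 u ≡ u
  vertex≡ zero             = refl
  vertex≡ (suc zero)       = refl
  vertex≡ (suc (suc zero)) = refl

1·K₃⊑K₃ : (1 · K 3) ⊑ K 3
1·K₃⊑K₃ = record
  { ⟦_⟧       = id
  ; injective = id
  ; edge      = λ (_ , v≢w) → v≢w ∘ cong (Fin.remainder {1} 3)
  }

mainTheorem5 : (r : ℕ) → r ℕ.≥ 1 →
    (π[ 3 ℕ.* r ] r · K 3 ≐ (- 1ℚ ⊕ √ (+ 5 / 1)) ⊘ (+ 2 / 1)) ×
    (π[ 3 ] K 3 ≐ (- 1ℚ ⊕ √ (+ 5 / 1)) ⊘ (+ 2 / 1))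
-- Matching on `suc` makes `3 * r` compute to a successor, so that part zero exists for the apices.
mainTheorem5 r@(suc _) _ =
  critical-1/φ (λ G → triangles⇒r·K₃ G (ℕ.*-comm 3 r))
               (λ n M → ¬HasTraversal-apex {r} {n = n} {M} (ℕ.*-comm 3 r)) ,
  critical-1/φ (λ G → HasTraversal-⊑ {G = G} K₃⊑1·K₃ ∘ triangles⇒r·K₃ G refl)
               (λ n M → ¬HasTraversal-apex {1} {n = n} {M} refl ∘
                  HasTraversal-⊑ {G = ApexGraph.partite 2 n M} 1·K₃⊑K₃)
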